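{- Let $G$ be a finite group acting on a sandpile graph $\Gamma=(V,E,\mathrm{wt},s)$ with non-sink vertex set $\widetilde V$, let $\mathcal{O}=\{Gv:v\in\widetilde V\}$ be the set of orbits of non-sink vertices, and let $\widetilde\Delta^G\colon\mathbb{Z}\mathcal{O}\to\mathbb{Z}\mathcal{O}$ be the symmetrized reduced Laplacian. Let $r\colon\mathbb{Z}\widetilde V/\mathrm{image}(\widetilde\Delta)\to\mathcal{S}(\Gamma)$ denote the inverse of the isomorphism $\mathcal{S}(\Gamma)\to\mathbb{Z}\widetilde V/\mathrm{image}(\widetilde\Delta)$, $c\mapsto c$. Then there is an isomorphism of groups $$\phi\colon\mathbb{Z}\mathcal{O}/\mathrm{image}(\widetilde\Delta^G)\to\mathcal{S}(\Gamma)^G$$ determined by $Gv\mapsto r\left(\sum_{w\in Gv}w\right)$ for $v\in\widetilde V$.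
   Context: Sandpile graph: $\Gamma=(V,E,\mathrm{wt},s)$ is a finite directed graph with edge-weight function $\mathrm{wt}\colon V\times V\to\mathbb{N}=\{0,1,2,\dots\}$, $\mathrm{wt}(v,w)>0$ iff $(v,w)\in E$, and a vertex $s$ (the sink) such that every vertex has a directed path to $s$. Let $\widetilde V=V\setminus\{s\}$ and $\mathrm{outdeg}(v)=\sum_{w\in V}\mathrm{wt}(v,w)$. Configurations: a configuration is an element $c=\sum_{v\in\widetilde V}c_v v\in\mathbb{N}\widetilde V$. A vertex $v\in\widetilde V$ is unstable in $c$ if $c_v\ge\mathrm{outdeg}(v)$; firing it replaces $c$ by $c-\mathrm{outdeg}(v)v+\sum_{w\in\widetilde V}\mathrm{wt}(v,w)w$. Repeatedly firing unstable vertices leads in finitely many steps to a stable configuration (no unstable vertices) $c^\circ$, independent of the choices made. A configuration $c$ is recurrent if it is stable and for every configuration $a$ there is a configuration $b$ with $(a+b)^\circ=c$. The recurrent configurations form a group under $(a,b)\mapsto(a+b)^\circ$, the sandpile group $\mathcal{S}(\Gamma)$. Reduced Laplacian: $\widetilde\Delta\colon\mathbb{Z}\widetilde V\to\mathbb{Z}\widetilde V$, $\widetilde\Delta(v)=\mathrm{outdeg}(v)v-\sum_{w\in\widetilde V}\mathrm{wt}(v,w)w$. It is well known that sending a recurrent configuration to its class gives an isomorphism $\mathcal{S}(\Gamma)\to\mathbb{Z}\widetilde V/\mathrm{image}(\widetilde\Delta)$. Action: an action of $G$ on $\Gamma$ is an action of $G$ on the set $V$ with $gs=s$ for all $g\in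 G$ and such that $(v,w)\in E$ implies $(gv,gw)\in E$ with both edges having the same weight. It extends linearly to $\mathbb{Z}\widetilde V$ and to configurations. $\mathcal{S}(\Gamma)^G$ denotes the subgroup of $\mathcal{S}(\Gamma)$ of recurrent configurations $c$ with $gc=c$ for all $g\in G$. Symmetrized reduced Laplacian: the $\mathbb{Z}$-linear map $\widetilde\Delta^G\colon\mathbb{Z}\mathcal{O}\to\mathbb{Z}\mathcal{O}$ such that for all $v,w\in\widetilde V$ the $Gw$-th component of $\widetilde\Delta^G(Gv)$ is the $w$-th component of $\sum_{u\in Gv}\widetilde\Delta(u)$ (this does not depend on the choice of representative $w$ of its orbit). -}

module Defs where

open import Data.Bool.Base using (if_then_else_)
open import Data.Nat.Base using (ℕ; zero; suc; _+_; _*_; _∸_; _^_; _≤_; _<_; z≤n; s≤s; s≤s⁻¹)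
import Data.Nat.Properties as ℕ
open import Data.Nat.Induction using (Acc; acc; <-wellFounded)
import Data.Nat.Tactic.RingSolver as ℕ-Solver
open import Data.Fin.Base using (Fin; zero; suc; punchIn; punchOut)
open import Data.Fin.Properties using (_≟_; any?; punchInᵢ≢i; punchIn-injective; punchIn-punchOut)
open import Data.Product.Base using (Σ; ∃; _×_; _,_; proj₁; proj₂)
open import Function.Base using (_∘_)
open import Function.Bundles using (Inverse; mk⇔)
open import Relation.Nullary using (¬_; Dec; yes; no; does; contradiction)
open import Relation.Nullary.Decidable using (_×-dec_; map′; dec-true; dec-false; does-⇔)
open import Relation.Binary.PropositionalEquality hiding ([_])
open import Relation.Binary.Construct.Closure.ReflexiveTransitive using (Star; ε; _◅_)
open import Relation.Binary.Bundles using (Setoid)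
import Relation.Binary.Reasoning.Setoid as SetoidReasoning
open import Data.Integer.Base as ℤ using (ℤ; +_; -[1+_]; 0ℤ; ∣_∣)
import Data.Integer.Properties as ℤ
import Data.Integer.Tactic.RingSolver as ℤ-Solver
open import Data.List.Base as List using (List; []; _∷_; _++_; replicate; allFin; deduplicate)
open import Data.List.Membership.Propositional using (_∈_)
open import Data.List.Membership.Propositional.Properties
  using (∈-map⁺; ∈-map⁻; ∈-allFin; ∈-lookup; ∈-deduplicate⁺; ∈-deduplicate⁻)
import Data.List.Relation.Unary.Any as Any
import Data.List.Relation.Unary.Any.Properties as Any
open import Data.Fin.Subset using (Subset)
open import Data.Fin.Permutation using (Permutation′; permutation)
import Data.Bool.Properties as Bool
open import Data.Vec.Base using (lookup; tabulate)
open import Data.Vec.Properties using (≡-dec; lookup∘tabulate)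
open import Level using (Level; 0ℓ; _⊔_) renaming (suc to lsuc)
open import Algebra.Bundles using (AbelianGroup; Group)
open import Algebra.Morphism.Structures using (IsGroupIsomorphism)
import Algebra.Properties.Group as GroupProperties
import Algebra.Properties.Semiring.Sum as SemiringSum

module ∑ℕ = SemiringSum ℕ.+-*-semiring
module ∑ℤ = SemiringSum ℤ.+-*-semiring

δ : ∀ {m} → Fin m → Fin m → ℕ
δ i j = if does (i ≟ j) then 1 else 0

δ-refl : ∀ {m} (i : Fin m) → δ i i ≡ 1
δ-refl i rewrite dec-true (i ≟ i) refl = refl

δ-≢ : ∀ {m} {i j : Fin m} → i ≢ j → δ i j ≡ 0
δ-≢ {i = i} {j} i≢j rewrite dec-false (i ≟ j) i≢j = refl

∑-zero : ∀ {m} {f : Fin m → ℕ} → (∀ i → f i ≡ 0) → ∑ℕ.sum f ≡ 0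
∑-zero {m} f≡0 = trans (∑ℕ.sum-cong-≗ f≡0) (∑ℕ.sum-replicate-zero m)

∑-δ : ∀ {m} (i : Fin m) (f : Fin m → ℕ) → ∑ℕ.sum (λ j → δ i j * f j) ≡ f i
∑-δ zero    f = trans (cong₂ _+_ (ℕ.+-identityʳ (f zero)) (∑-zero {f = λ j → δ zero (suc j) * f (suc j)} λ _ → refl)) (ℕ.+-identityʳ (f zero))
∑-δ (suc i) f = ∑-δ i (f ∘ suc)

∑-mono : ∀ {m} {f g : Fin m → ℕ} → (∀ i → f i ≤ g i) → ∑ℕ.sum f ≤ ∑ℕ.sum g
∑-mono {zero}  f≤g = z≤n
∑-mono {suc m} f≤g = ℕ.+-mono-≤ (f≤g zero) (∑-mono (f≤g ∘ suc))

term≤∑ : ∀ {m} (f : Fin m → ℕ) i → f i ≤ ∑ℕ.sum f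
term≤∑ f zero    = ℕ.m≤m+n _ _
term≤∑ f (suc i) = ℕ.≤-trans (term≤∑ (f ∘ suc) i) (ℕ.m≤n+m _ _)

least : (P : ℕ → Set) → (∀ k → Dec (P k)) → ∀ k → P k → ∃ λ m → P m × (∀ j → P j → m ≤ j)
least P P? zero    p = zero , p , λ _ _ → z≤n
least P P? (suc k) p with P? zero
... | yes p₀ = zero , p₀ , λ _ _ → z≤n
... | no ¬p₀ with least (P ∘ suc) (P? ∘ suc) k p
...   | m , pm , min = suc m , pm , λ { zero pj → contradiction pj ¬p₀ ; (suc j) pj → s≤s (min j pj) }

record SandpileGraph : Set where
  field
    n  : ℕ
    wt : Fin (suc n) → Fin (suc n) → ℕ
    s  : Fin (suc n)

  V : Set
  V = Fin (suc n)

  E : V → V → Set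
  E v w = 0 < wt v w

  field
    path : ∀ v → Star E v s

  -- The non-sink vertices, embedded into V by punchIn s.
  Ṽ : Set
  Ṽ = Fin n

  ι : Ṽ → V
  ι = punchIn s

  outdeg : V → ℕ
  outdeg v = ∑ℕ.sum (wt v)

module Firing (Γ : SandpileGraph) where
  open SandpileGraph Γ

  Config : Set
  Config = Ṽ → ℕ

  _⊕_ : Config → Config → Config
  (a ⊕ b) v = a v + b v

  Unstable : Config → Ṽ → Set
  Unstable c v = outdeg (ι v) ≤ c v

  Stable : Config → Set
  Stable c = ∀ v → ¬ Unstable c v

  -- Only meaningful when v is unstable in c; then ∸ does not truncate.
  fire : Config → Ṽ → Config
  fire c v w = (c w ∸ outdeg (ι v) * δ v w) + wt (ι v) (ι w)

  -- c ↠ d: some sequence of firings of unstable vertices leads from c to d.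
  data _↠_ : Config → Config → Set where
    done : ∀ {c d} → c ≗ d → c ↠ d
    step : ∀ {c d} v → Unstable c v → fire c v ↠ d → c ↠ d

  fire-eq : ∀ c v w → Unstable c v →
            fire c v w + outdeg (ι v) * δ v w ≡ c w + wt (ι v) (ι w)
  fire-eq c v w u = begin
    (c w ∸ k) + wt (ι v) (ι w) + k  ≡⟨ ℕ.+-assoc (c w ∸ k) _ k ⟩
    (c w ∸ k) + (wt (ι v) (ι w) + k)  ≡⟨ cong (λ x → (c w ∸ k) + x) (ℕ.+-comm _ k) ⟩
    (c w ∸ k) + (k + wt (ι v) (ι w))  ≡⟨ ℕ.+-assoc (c w ∸ k) k _ ⟨
    (c w ∸ k) + k + wt (ι v) (ι w)  ≡⟨ cong (_+ wt (ι v) (ι w)) (ℕ.m∸n+n≡m k≤) ⟩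
    c w + wt (ι v) (ι w) ∎
    where
    open ≡-Reasoning
    k = outdeg (ι v) * δ v w
    k≤ : k ≤ c w
    k≤ with v ≟ w
    ... | yes refl = ℕ.≤-trans (ℕ.≤-reflexive (ℕ.*-identityʳ _)) u
    ... | no _     = ℕ.≤-trans (ℕ.≤-reflexive (ℕ.*-zeroʳ (outdeg (ι v)))) z≤n

  fire-cong : ∀ {c d} v → c ≗ d → fire c v ≗ fire d v
  fire-cong v c≗d w = cong (λ x → (x ∸ outdeg (ι v) * δ v w) + wt (ι v) (ι w)) (c≗d w)

  unstable-cong : ∀ {c d v} → c ≗ d → Unstable c v → Unstable d v
  unstable-cong {v = v} c≗d = subst (outdeg (ι v) ≤_) (c≗d v)

  stable-cong : ∀ {c d} → c ≗ d → Stable c → Stable d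
  stable-cong c≗d st v u = st v (unstable-cong (sym ∘ c≗d) u)

  ↠-respˡ : ∀ {c c′ d} → c ≗ c′ → c ↠ d → c′ ↠ d
  ↠-respˡ e (done p)     = done λ v → trans (sym (e v)) (p v)
  ↠-respˡ e (step v u p) = step v (unstable-cong e u) (↠-respˡ (fire-cong v e) p)

  ↠-respʳ : ∀ {c d d′} → d ≗ d′ → c ↠ d → c ↠ d′
  ↠-respʳ e (done p)     = done λ v → trans (p v) (e v)
  ↠-respʳ e (step v u p) = step v u (↠-respʳ e p)

  ↠-trans : ∀ {c d e} → c ↠ d → d ↠ e → c ↠ e
  ↠-trans (done p)     q = ↠-respˡ (sym ∘ p) q
  ↠-trans (step v u p) q = step v u (↠-trans p q)

  fire-unstable : ∀ c {u v} → u ≢ v → Unstable c u → Unstable c v → Unstable (fire c u) v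
  fire-unstable c {u} {v} u≢v uu uv = ℕ.≤-trans uv (ℕ.≤-trans (ℕ.m≤m+n _ _) (ℕ.≤-reflexive (begin
    c v + wt (ι u) (ι v)                ≡⟨ fire-eq c u v uu ⟨
    fire c u v + outdeg (ι u) * δ u v   ≡⟨ cong (λ x → fire c u v + outdeg (ι u) * x) (δ-≢ u≢v) ⟩
    fire c u v + outdeg (ι u) * 0       ≡⟨ cong (λ x → fire c u v + x) (ℕ.*-zeroʳ (outdeg (ι u))) ⟩
    fire c u v + 0                      ≡⟨ ℕ.+-identityʳ _ ⟩
    fire c u v ∎)))
    where open ≡-Reasoning

  fire-comm : ∀ c {u v} → u ≢ v → Unstable c u → Unstable c v →
              fire (fire c u) v ≗ fire (fire c v) u
  fire-comm c {u} {v} u≢v uu uv w =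
    ℕ.+-cancelʳ-≡ (kᵤ + kᵥ) _ _ (trans lhs (sym rhs))
    where
    open ≡-Reasoning
    kᵤ = outdeg (ι u) * δ u w
    kᵥ = outdeg (ι v) * δ v w
    wᵤ = wt (ι u) (ι w)
    wᵥ = wt (ι v) (ι w)
    swap₂ : ∀ x a b → x + (a + b) ≡ x + b + a
    swap₂ = ℕ-Solver.solve-∀
    swap₃ : ∀ x a b → x + a + b ≡ x + b + a
    swap₃ = ℕ-Solver.solve-∀
    lhs : fire (fire c u) v w + (kᵤ + kᵥ) ≡ c w + wᵤ + wᵥ
    lhs = begin
      fire (fire c u) v w + (kᵤ + kᵥ)   ≡⟨ swap₂ (fire (fire c u) v w) kᵤ kᵥ ⟩
      fire (fire c u) v w + kᵥ + kᵤ     ≡⟨ cong (_+ kᵤ) (fire-eq (fire c u) v w (fire-unstable c u≢v uu uv)) ⟩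
      fire c u w + wᵥ + kᵤ              ≡⟨ swap₃ (fire c u w) wᵥ kᵤ ⟩
      fire c u w + kᵤ + wᵥ              ≡⟨ cong (_+ wᵥ) (fire-eq c u w uu) ⟩
      c w + wᵤ + wᵥ ∎
    rhs : fire (fire c v) u w + (kᵤ + kᵥ) ≡ c w + wᵤ + wᵥ
    rhs = begin
      fire (fire c v) u w + (kᵤ + kᵥ)   ≡⟨ ℕ.+-assoc (fire (fire c v) u w) kᵤ kᵥ ⟨
      fire (fire c v) u w + kᵤ + kᵥ     ≡⟨ cong (_+ kᵥ) (fire-eq (fire c v) u w (fire-unstable c (u≢v ∘ sym) uv uu)) ⟩
      fire c v w + wᵤ + kᵥ              ≡⟨ swap₃ (fire c v w) wᵤ kᵥ ⟩
      fire c v w + kᵥ + wᵤ              ≡⟨ cong (_+ wᵤ) (fire-eq c v w uv) ⟩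
      c w + wᵥ + wᵤ                     ≡⟨ swap₃ (c w) wᵥ wᵤ ⟩
      c w + wᵤ + wᵥ ∎

  exchange : ∀ {c d} v → Unstable c v → Stable d → c ↠ d → fire c v ↠ d
  exchange v uv st (done p) = contradiction (unstable-cong p uv) (st v)
  exchange {c} v uv st (step u uu p) with u ≟ v
  ... | yes refl = p
  ... | no u≢v = step u (fire-unstable c (u≢v ∘ sym) uv uu)
                   (↠-respˡ (fire-comm c u≢v uu uv) (exchange v (fire-unstable c u≢v uu uv) st p))

  ↠-unique : ∀ {c d e} → c ↠ d → Stable d → c ↠ e → Stable e → d ≗ e
  ↠-unique (done p) st (done q) _ v = trans (sym (p v)) (q v)
  ↠-unique (done p) st (step v u _) _ = contradiction (unstable-cong p u) (st v)
  ↠-unique (step v u p) st q st′ = ↠-unique p st (exchange v u st′ q) st′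

  ↠-⊕ : ∀ {c d} a → c ↠ d → (c ⊕ a) ↠ (d ⊕ a)
  ↠-⊕ a (done p) = done λ v → cong (_+ a v) (p v)
  ↠-⊕ {c} a (step v u p) = step v u′ (↠-respˡ eq (↠-⊕ a p))
    where
    open ≡-Reasoning
    u′ : Unstable (c ⊕ a) v
    u′ = ℕ.≤-trans u (ℕ.m≤m+n _ _)
    swap₃ : ∀ x a b → x + a + b ≡ x + b + a
    swap₃ = ℕ-Solver.solve-∀
    eq : (fire c v ⊕ a) ≗ fire (c ⊕ a) v
    eq w = ℕ.+-cancelʳ-≡ k _ _ (begin
      fire c v w + a w + k         ≡⟨ swap₃ (fire c v w) (a w) k ⟩
      fire c v w + k + a w         ≡⟨ cong (_+ a w) (fire-eq c v w u) ⟩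
      c w + wt (ι v) (ι w) + a w   ≡⟨ swap₃ (c w) _ (a w) ⟩
      c w + a w + wt (ι v) (ι w)   ≡⟨ fire-eq (c ⊕ a) v w u′ ⟨
      fire (c ⊕ a) v w + k ∎)
      where k = outdeg (ι v) * δ v w

  -- Termination: with d(v) the distance from v to the sink, D = ∑ d and
  -- B = 1 + ∑ outdeg, the potential of v is h(v) = B^D - B^(D - d(v)).
  -- It vanishes at s, and every firing strictly decreases ∑ c(v) h(v).

  Walk : ℕ → V → Set
  Walk zero    v = v ≡ s
  Walk (suc k) v = ∃ λ w → E v w × Walk k w

  walk? : ∀ k v → Dec (Walk k v)
  walk? zero    v = v ≟ s
  walk? (suc k) v = any? λ w → (0 ℕ.<? wt v w) ×-dec walk? k w

  walk : ∀ {v} → Star E v s → ∃ λ k → Walk k v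
  walk ε       = 0 , refl
  walk (e ◅ p) = let k , q = walk p in suc k , _ , e , q

  distance : ∀ v → ∃ λ k → Walk k v × (∀ j → Walk j v → k ≤ j)
  distance v = let k , p = walk (path v) in least (λ j → Walk j v) (λ j → walk? j v) k p

  dist : V → ℕ
  dist v = proj₁ (distance v)

  dist-s : dist s ≡ 0
  dist-s = ℕ.n≤0⇒n≡0 (proj₂ (proj₂ (distance s)) 0 refl)

  closer : ∀ v → v ≢ s → ∃ λ w → E v w × dist w < dist v
  closer v v≢s with distance v
  ... | zero  , v≡s , _ = contradiction v≡s v≢s
  ... | suc k , (w , e , q) , _ = w , e , s≤s (proj₂ (proj₂ (distance w)) k q)

  D B : ℕ
  D = ∑ℕ.sum dist
  B = suc (∑ℕ.sum outdeg)

  k̂ h : V → ℕ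
  k̂ v = B ^ (D ∸ dist v)
  h v = B ^ D ∸ k̂ v

  h+k̂ : ∀ v → h v + k̂ v ≡ B ^ D
  h+k̂ v = ℕ.m∸n+n≡m (ℕ.^-monoʳ-≤ B (ℕ.m∸n≤m D (dist v)))

  h-s : h s ≡ 0
  h-s rewrite dist-s = ℕ.n∸n≡0 (B ^ D)

  k̂-grows : ∀ v → v ≢ s → outdeg v * k̂ v < ∑ℕ.sum (λ w → wt v w * k̂ w)
  k̂-grows v v≢s with closer v v≢s
  ... | w , e , dw<dv = begin-strict
    outdeg v * k̂ v             <⟨ ℕ.*-monoˡ-< (k̂ v) ⦃ ℕ.m^n≢0 B (D ∸ dist v) ⦄ (s≤s (term≤∑ outdeg v)) ⟩
    B * k̂ v                    ≡⟨⟩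
    B ^ suc (D ∸ dist v)       ≤⟨ ℕ.^-monoʳ-≤ B exp≤ ⟩
    k̂ w                        ≡⟨ ℕ.*-identityˡ (k̂ w) ⟨
    1 * k̂ w                    ≤⟨ ℕ.*-monoˡ-≤ (k̂ w) e ⟩
    wt v w * k̂ w               ≤⟨ term≤∑ (λ w → wt v w * k̂ w) w ⟩
    ∑ℕ.sum (λ w → wt v w * k̂ w) ∎
    where
    open ℕ.≤-Reasoning
    exp≤ : suc (D ∸ dist v) ≤ D ∸ dist w
    exp≤ = ℕ.∸-monoʳ-< dw<dv (term≤∑ dist v)

  h-shrinks : ∀ v → v ≢ s → ∑ℕ.sum (λ w → wt v w * h w) < outdeg v * h v
  h-shrinks v v≢s = ℕ.+-cancelʳ-< (outdeg v * k̂ v) _ _ (begin-strict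
    ∑ℕ.sum (λ w → wt v w * h w) + outdeg v * k̂ v
      <⟨ ℕ.+-monoʳ-< (∑ℕ.sum (λ w → wt v w * h w)) (k̂-grows v v≢s) ⟩
    ∑ℕ.sum (λ w → wt v w * h w) + ∑ℕ.sum (λ w → wt v w * k̂ w)
      ≡⟨ ∑ℕ.∑-distrib-+ (λ w → wt v w * h w) (λ w → wt v w * k̂ w) ⟨
    ∑ℕ.sum (λ w → wt v w * h w + wt v w * k̂ w)
      ≡⟨ ∑ℕ.sum-cong-≗ (λ w → trans (sym (ℕ.*-distribˡ-+ (wt v w) (h w) (k̂ w))) (cong (wt v w *_) (h+k̂ w))) ⟩
    ∑ℕ.sum (λ w → wt v w * B ^ D)
      ≡⟨ ∑ℕ.*-distribʳ-sum (B ^ D) (wt v) ⟨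
    outdeg v * B ^ D
      ≡⟨ cong (outdeg v *_) (h+k̂ v) ⟨
    outdeg v * (h v + k̂ v)
      ≡⟨ ℕ.*-distribˡ-+ (outdeg v) (h v) (k̂ v) ⟩
    outdeg v * h v + outdeg v * k̂ v ∎)
    where open ℕ.≤-Reasoning

  μ : Config → ℕ
  μ c = ∑ℕ.sum (λ w → c w * h (ι w))

  ∑-drop-s : (f : V → ℕ) → f s ≡ 0 → ∑ℕ.sum f ≡ ∑ℕ.sum (f ∘ ι)
  ∑-drop-s f fs≡0 = trans (∑ℕ.sum-remove {i = s} f) (cong (_+ ∑ℕ.sum (f ∘ ι)) fs≡0)

  μ-decreases : ∀ c v → Unstable c v → μ (fire c v) < μ c
  μ-decreases c v u = ℕ.+-cancelʳ-< (o * h (ι v)) _ _ (begin-strict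
    μ (fire c v) + o * h (ι v)
      ≡⟨ cong (λ x → μ (fire c v) + o * x) (∑-δ v (h ∘ ι)) ⟨
    μ (fire c v) + o * ∑ℕ.sum (λ w → δ v w * h (ι w))
      ≡⟨ cong (λ x → μ (fire c v) + x) (∑ℕ.*-distribˡ-sum o (λ w → δ v w * h (ι w))) ⟩
    μ (fire c v) + ∑ℕ.sum (λ w → o * (δ v w * h (ι w)))
      ≡⟨ ∑ℕ.∑-distrib-+ (λ w → fire c v w * h (ι w)) (λ w → o * (δ v w * h (ι w))) ⟨
    ∑ℕ.sum (λ w → fire c v w * h (ι w) + o * (δ v w * h (ι w)))
      ≡⟨ ∑ℕ.sum-cong-≗ pointwise ⟩
    ∑ℕ.sum (λ w → c w * h (ι w) + wt (ι v) (ι w) * h (ι w))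
      ≡⟨ ∑ℕ.∑-distrib-+ (λ w → c w * h (ι w)) (λ w → wt (ι v) (ι w) * h (ι w)) ⟩
    μ c + ∑ℕ.sum (λ w → wt (ι v) (ι w) * h (ι w))
      ≡⟨ cong (λ x → μ c + x) (∑-drop-s (λ w → wt (ι v) w * h w) (trans (cong (wt (ι v) s *_) h-s) (ℕ.*-zeroʳ (wt (ι v) s)))) ⟨
    μ c + ∑ℕ.sum (λ w → wt (ι v) w * h w)
      <⟨ ℕ.+-monoʳ-< (μ c) (h-shrinks (ι v) (punchInᵢ≢i s v)) ⟩
    μ c + o * h (ι v) ∎)
    where
    open ℕ.≤-Reasoning
    o = outdeg (ι v)
    pointwise : ∀ w → fire c v w * h (ι w) + o * (δ v w * h (ι w)) ≡ c w * h (ι w) + wt (ι v) (ι w) * h (ι w)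
    pointwise w = trans (lem (fire c v w) o (δ v w) (h (ι w)))
                    (trans (cong (_* h (ι w)) (fire-eq c v w u)) (ℕ.*-distribʳ-+ (h (ι w)) (c w) _))
      where
      lem : ∀ f o d h → f * h + o * (d * h) ≡ (f + o * d) * h
      lem = ℕ-Solver.solve-∀

  stabilize : ∀ c → Acc _<_ (μ c) → ∃ λ d → c ↠ d × Stable d
  stabilize c (acc rs) with any? (λ v → outdeg (ι v) ℕ.≤? c v)
  ... | no  st      = c , done (λ _ → refl) , λ v u → st (v , u)
  ... | yes (v , u) = let d , p , st = stabilize (fire c v) (rs (μ-decreases c v u)) in d , step v u p , st

  infix 25 _°

  _° : Config → Config
  c ° = proj₁ (stabilize c (<-wellFounded (μ c)))

  ↠° : ∀ c → c ↠ c °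
  ↠° c = proj₁ (proj₂ (stabilize c (<-wellFounded (μ c))))

  °-stable : ∀ c → Stable (c °)
  °-stable c = proj₂ (proj₂ (stabilize c (<-wellFounded (μ c))))

  °-unique : ∀ {c d} → c ↠ d → Stable d → c ° ≗ d
  °-unique {c} p st = ↠-unique (↠° c) (°-stable c) p st

basis : ∀ {m} → Fin m → (Fin m → ℤ)
basis i j = + δ i j

-- The linear map sending basis i to M i.
linear : ∀ {k m} → (Fin k → Fin m → ℤ) → (Fin k → ℤ) → (Fin m → ℤ)
linear M z w = ∑ℤ.sum λ v → z v ℤ.* M v w

linear-+ : ∀ {k m} (M : Fin k → Fin m → ℤ) y z w →
           linear M (λ v → y v ℤ.+ z v) w ≡ linear M y w ℤ.+ linear M z w
linear-+ M y z w = trans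
  (∑ℤ.sum-cong-≗ λ v → ℤ.*-distribʳ-+ (M v w) (y v) (z v))
  (∑ℤ.∑-distrib-+ (λ v → y v ℤ.* M v w) (λ v → z v ℤ.* M v w))

linear-0 : ∀ {k m} (M : Fin k → Fin m → ℤ) w → linear M (λ _ → 0ℤ) w ≡ 0ℤ
linear-0 {k} M w = trans (∑ℤ.sum-cong-≗ λ v → ℤ.*-zeroˡ (M v w)) (∑ℤ.sum-replicate-zero k)

linear-neg : ∀ {k m} (M : Fin k → Fin m → ℤ) z w →
             linear M (λ v → ℤ.- z v) w ≡ ℤ.- linear M z w
linear-neg {k} M z w = GroupProperties.inverseˡ-unique ℤ-group
  (linear M (λ v → ℤ.- z v) w) (linear M z w)
  (trans (sym (linear-+ M (λ v → ℤ.- z v) z w))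
    (trans (∑ℤ.sum-cong-≗ λ v → cong (ℤ._* M v w) (ℤ.+-inverseˡ (z v))) (linear-0 M w)))
  where ℤ-group = AbelianGroup.group ℤ.+-0-abelianGroup

linear-basis : ∀ {k m} (M : Fin k → Fin m → ℤ) v w → linear M (basis v) w ≡ M v w
linear-basis M v w = go v (λ u → M u w)
  where
  go : ∀ {k} (i : Fin k) (f : Fin k → ℤ) → ∑ℤ.sum (λ j → basis i j ℤ.* f j) ≡ f i
  go zero f = trans
    (cong₂ ℤ._+_ (ℤ.*-identityˡ (f zero))
      (linear-0 (λ j (_ : Fin 1) → f (suc j)) zero))
    (ℤ.+-identityʳ (f zero))
  go (suc i) f = trans (cong₂ ℤ._+_ (ℤ.*-zeroˡ (f zero)) (go i (f ∘ suc))) (ℤ.+-identityˡ (f (suc i)))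

-- ℤᵐ / image (linear M): same carrier as ℤᵐ, coarser equality.
coker : ∀ {m} → (Fin m → Fin m → ℤ) → AbelianGroup 0ℓ 0ℓ
coker {m} M = record
  { Carrier = Fin m → ℤ
  ; _≈_     = λ x y → ∃ λ z → ∀ w → x w ℤ.- y w ≡ linear M z w
  ; _∙_     = λ x y w → x w ℤ.+ y w
  ; ε       = λ _ → 0ℤ
  ; _⁻¹     = λ x w → ℤ.- x w
  ; isAbelianGroup = record
    { isGroup = record
      { isMonoid = record
        { isSemigroup = record
          { isMagma = record
            { isEquivalence = record
              { refl  = λ {x} → ≗⇒≈ λ w → refl {x = x w}
              ; sym   = λ {x} {y} (z , p) → (λ v → ℤ.- z v) , λ w →
                          trans (lem-sym (x w) (y w)) (trans (cong ℤ.-_ (p w)) (sym (linear-neg M z w)))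
              ; trans = λ {x} {y} {u} (z , p) (z′ , q) → (λ v → z v ℤ.+ z′ v) , λ w →
                          trans (lem-trans (x w) (y w) (u w))
                            (trans (cong₂ ℤ._+_ (p w) (q w)) (sym (linear-+ M z z′ w)))
              }
            ; ∙-cong = λ {x} {y} {u} {v} (z , p) (z′ , q) → (λ v → z v ℤ.+ z′ v) , λ w →
                         trans (lem-∙ (x w) (y w) (u w) (v w))
                           (trans (cong₂ ℤ._+_ (p w) (q w)) (sym (linear-+ M z z′ w)))
            }
          ; assoc = λ x y z → ≗⇒≈ λ w → ℤ.+-assoc (x w) (y w) (z w)
          }
        ; identity = (λ x → ≗⇒≈ λ w → ℤ.+-identityˡ (x w)) , (λ x → ≗⇒≈ λ w → ℤ.+-identityʳ (x w))
        }
      ; inverse = (λ x → ≗⇒≈ λ w → ℤ.+-inverseˡ (x w)) , (λ x → ≗⇒≈ λ w → ℤ.+-inverseʳ (x w))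
      ; ⁻¹-cong = λ {x} {y} (z , p) → (λ v → ℤ.- z v) , λ w →
                    trans (lem-neg (x w) (y w)) (trans (cong ℤ.-_ (p w)) (sym (linear-neg M z w)))
      }
    ; comm = λ x y → ≗⇒≈ λ w → ℤ.+-comm (x w) (y w)
    }
  }
  where
  ≗⇒≈ : {x y : Fin m → ℤ} → x ≗ y → ∃ λ z → ∀ w → x w ℤ.- y w ≡ linear M z w
  ≗⇒≈ {x} {y} p = (λ _ → 0ℤ) , λ w → trans (ℤ.i≡j⇒i-j≡0 (p w)) (sym (linear-0 M w))
  lem-sym : ∀ x y → y ℤ.- x ≡ ℤ.- (x ℤ.- y)
  lem-sym = ℤ-Solver.solve-∀
  lem-trans : ∀ x y u → x ℤ.- u ≡ (x ℤ.- y) ℤ.+ (y ℤ.- u)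
  lem-trans = ℤ-Solver.solve-∀
  lem-∙ : ∀ x y u v → (x ℤ.+ u) ℤ.- (y ℤ.+ v) ≡ (x ℤ.- y) ℤ.+ (u ℤ.- v)
  lem-∙ = ℤ-Solver.solve-∀
  lem-neg : ∀ x y → (ℤ.- x) ℤ.- (ℤ.- y) ≡ ℤ.- (x ℤ.- y)
  lem-neg = ℤ-Solver.solve-∀

module SandpileGroup (Γ : SandpileGraph) where
  open SandpileGraph Γ
  open Firing Γ public

  Recurrent : Config → Set
  Recurrent c = Stable c × (∀ a → ∃ λ b → (a ⊕ b) ° ≗ c)

  °-↠ : ∀ {c d} → c ↠ d → c ° ≗ d °
  °-↠ {_} {d} p = °-unique (↠-trans p (↠° d)) (°-stable d)

  °-cong : ∀ {c d} → c ≗ d → c ° ≗ d °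
  °-cong p = °-↠ (done p)

  °-of-stable : ∀ {c} → Stable c → c ° ≗ c
  °-of-stable st = °-unique (done λ _ → refl) st

  ⊕-comm : ∀ a b → (a ⊕ b) ≗ (b ⊕ a)
  ⊕-comm a b v = ℕ.+-comm (a v) (b v)

  ⊕-assoc : ∀ a b c → ((a ⊕ b) ⊕ c) ≗ (a ⊕ (b ⊕ c))
  ⊕-assoc a b c v = ℕ.+-assoc (a v) (b v) (c v)

  ⊕-congˡ : ∀ a {b c} → b ≗ c → (a ⊕ b) ≗ (a ⊕ c)
  ⊕-congˡ a p v = cong (λ x → a v + x) (p v)

  ⊕-congʳ : ∀ a {b c} → b ≗ c → (b ⊕ a) ≗ (c ⊕ a)
  ⊕-congʳ a p v = cong (_+ a v) (p v)

  °-⊕ˡ : ∀ c a → (c ° ⊕ a) ° ≗ (c ⊕ a) °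
  °-⊕ˡ c a = sym ∘ °-↠ (↠-⊕ a (↠° c))

  °-⊕ʳ : ∀ a c → (a ⊕ c °) ° ≗ (a ⊕ c) °
  °-⊕ʳ a c v = trans (°-cong (⊕-comm a (c °)) v) (trans (°-⊕ˡ c a v) (°-cong (⊕-comm c a) v))

  ConfigSetoid : Setoid 0ℓ 0ℓ
  ConfigSetoid = Ṽ →-setoid ℕ

  module ≗-Reasoning = SetoidReasoning ConfigSetoid

  recurrent-⊕ : ∀ {c} → Recurrent c → ∀ d → Recurrent ((c ⊕ d) °)
  recurrent-⊕ {c} (_ , rec) d = °-stable (c ⊕ d) , λ a → let b , p = rec a in b ⊕ d , (begin
    (a ⊕ (b ⊕ d)) °     ≈⟨ °-cong (⊕-assoc a b d) ⟨
    ((a ⊕ b) ⊕ d) °     ≈⟨ °-⊕ˡ (a ⊕ b) d ⟨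
    ((a ⊕ b) ° ⊕ d) °   ≈⟨ °-cong (⊕-congʳ d p) ⟩
    (c ⊕ d) ° ∎)
    where open ≗-Reasoning

  maxStable : Config
  maxStable v = outdeg (ι v) ∸ 1

  outdeg>0 : ∀ v → 0 < outdeg (ι v)
  outdeg>0 v = let w , e , _ = closer (ι v) (punchInᵢ≢i s v) in ℕ.≤-trans e (term≤∑ (wt (ι v)) w)

  suc-maxStable : ∀ v → suc (maxStable v) ≡ outdeg (ι v)
  suc-maxStable v = ℕ.m+[n∸m]≡n (outdeg>0 v)

  maxStable-stable : Stable maxStable
  maxStable-stable v u = ℕ.1+n≰n (ℕ.≤-trans (ℕ.≤-reflexive (suc-maxStable v)) u)

  stable≤max : ∀ {c} → Stable c → ∀ v → c v ≤ maxStable v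
  stable≤max {c} st v = s≤s⁻¹ (ℕ.≤-trans (ℕ.≰⇒> (st v)) (ℕ.≤-reflexive (sym (suc-maxStable v))))

  maxStable-recurrent : Recurrent maxStable
  maxStable-recurrent = maxStable-stable , λ a → let b = λ v → maxStable v ∸ (a °) v in b , (begin
    (a ⊕ b) °     ≈⟨ °-⊕ˡ a b ⟨
    (a ° ⊕ b) °   ≈⟨ °-cong (λ v → ℕ.m+[n∸m]≡n (stable≤max (°-stable a) v)) ⟩
    maxStable °   ≈⟨ °-of-stable maxStable-stable ⟩
    maxStable ∎)
    where open ≗-Reasoning

  RecurrentConfig : Set
  RecurrentConfig = Σ Config Recurrent

  _⊞_ : RecurrentConfig → RecurrentConfig → RecurrentConfig
  (c , c-rec) ⊞ (d , _) = (c ⊕ d) ° , recurrent-⊕ c-rec d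

  -- The neutral element: if (2m + b)° = m for some recurrent m, then (m + b)°
  -- acts neutrally on m, hence on every (m + a)°, i.e. on every recurrent element.
  neutral : RecurrentConfig
  neutral = let b , _ = proj₂ maxStable-recurrent (maxStable ⊕ maxStable)
            in (maxStable ⊕ b) ° , recurrent-⊕ maxStable-recurrent b

  e : Config
  e = proj₁ neutral

  m⊕e : (maxStable ⊕ e) ° ≗ maxStable
  m⊕e = let b , p = proj₂ maxStable-recurrent (maxStable ⊕ maxStable) in begin
    (maxStable ⊕ (maxStable ⊕ b) °) °   ≈⟨ °-⊕ʳ maxStable (maxStable ⊕ b) ⟩
    (maxStable ⊕ (maxStable ⊕ b)) °     ≈⟨ °-cong (⊕-assoc maxStable maxStable b) ⟨
    ((maxStable ⊕ maxStable) ⊕ b) °     ≈⟨ p ⟩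
    maxStable ∎
    where open ≗-Reasoning

  ⊕e : ∀ {c} → Recurrent c → (c ⊕ e) ° ≗ c
  ⊕e {c} (_ , rec) = let b , p = rec maxStable in begin
    (c ⊕ e) °                     ≈⟨ °-cong (⊕-congʳ e p) ⟨
    ((maxStable ⊕ b) ° ⊕ e) °     ≈⟨ °-⊕ˡ (maxStable ⊕ b) e ⟩
    ((maxStable ⊕ b) ⊕ e) °       ≈⟨ °-cong (⊕-assoc maxStable b e) ⟩
    (maxStable ⊕ (b ⊕ e)) °       ≈⟨ °-cong (⊕-congˡ maxStable (⊕-comm b e)) ⟩
    (maxStable ⊕ (e ⊕ b)) °       ≈⟨ °-cong (⊕-assoc maxStable e b) ⟨
    ((maxStable ⊕ e) ⊕ b) °       ≈⟨ °-⊕ˡ (maxStable ⊕ e) b ⟨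
    ((maxStable ⊕ e) ° ⊕ b) °     ≈⟨ °-cong (⊕-congʳ b m⊕e) ⟩
    (maxStable ⊕ b) °             ≈⟨ p ⟩
    c ∎
    where open ≗-Reasoning

  inverse : RecurrentConfig → RecurrentConfig
  inverse (c , _) = let b , _ = proj₂ (proj₂ neutral) c in (e ⊕ b) ° , recurrent-⊕ (proj₂ neutral) b

  ⊞-assoc : ∀ a b c → ((a ⊕ b) ° ⊕ c) ° ≗ (a ⊕ (b ⊕ c) °) °
  ⊞-assoc a b c = begin
    ((a ⊕ b) ° ⊕ c) °   ≈⟨ °-⊕ˡ (a ⊕ b) c ⟩
    ((a ⊕ b) ⊕ c) °     ≈⟨ °-cong (⊕-assoc a b c) ⟩
    (a ⊕ (b ⊕ c)) °     ≈⟨ °-⊕ʳ a (b ⊕ c) ⟨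
    (a ⊕ (b ⊕ c) °) ° ∎
    where open ≗-Reasoning

  ⊞-comm : ∀ a b → (a ⊕ b) ° ≗ (b ⊕ a) °
  ⊞-comm a b = °-cong (⊕-comm a b)

  ⊞-cong : ∀ {a b c d} → a ≗ b → c ≗ d → (a ⊕ c) ° ≗ (b ⊕ d) °
  ⊞-cong p q = °-cong λ v → cong₂ _+_ (p v) (q v)

  ⊞-inverse : ∀ c → (proj₁ c ⊕ proj₁ (inverse c)) ° ≗ e
  ⊞-inverse (c , _) = let b , p = proj₂ (proj₂ neutral) c in begin
    (c ⊕ (e ⊕ b) °) °   ≈⟨ °-⊕ʳ c (e ⊕ b) ⟩
    (c ⊕ (e ⊕ b)) °     ≈⟨ °-cong (⊕-congˡ c (⊕-comm e b)) ⟩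
    (c ⊕ (b ⊕ e)) °     ≈⟨ °-cong (⊕-assoc c b e) ⟨
    ((c ⊕ b) ⊕ e) °     ≈⟨ °-⊕ˡ (c ⊕ b) e ⟨
    ((c ⊕ b) ° ⊕ e) °   ≈⟨ °-cong (⊕-congʳ e p) ⟩
    (e ⊕ e) °           ≈⟨ ⊕e (proj₂ neutral) ⟩
    e ∎
    where open ≗-Reasoning

  ⊞-cancel : ∀ a c d → (proj₁ c ⊕ proj₁ a) ° ≗ (proj₁ d ⊕ proj₁ a) ° → proj₁ c ≗ proj₁ d
  ⊞-cancel a c d p = begin
    proj₁ c                               ≈⟨ undo c ⟨
    ((proj₁ c ⊕ proj₁ a) ° ⊕ a⁻¹) °       ≈⟨ °-cong (⊕-congʳ a⁻¹ p) ⟩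
    ((proj₁ d ⊕ proj₁ a) ° ⊕ a⁻¹) °       ≈⟨ undo d ⟩
    proj₁ d ∎
    where
    open ≗-Reasoning
    a⁻¹ = proj₁ (inverse a)
    undo : ∀ c → ((proj₁ c ⊕ proj₁ a) ° ⊕ a⁻¹) ° ≗ proj₁ c
    undo (c , c-rec) = begin
      ((c ⊕ proj₁ a) ° ⊕ a⁻¹) °   ≈⟨ ⊞-assoc c (proj₁ a) a⁻¹ ⟩
      (c ⊕ (proj₁ a ⊕ a⁻¹) °) °   ≈⟨ °-cong (⊕-congˡ c (⊞-inverse a)) ⟩
      (c ⊕ e) °                   ≈⟨ ⊕e c-rec ⟩
      c ∎

  𝒮 : AbelianGroup 0ℓ 0ℓ
  𝒮 = record
    { Carrier = RecurrentConfig
    ; _≈_     = λ c d → proj₁ c ≗ proj₁ d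
    ; _∙_     = _⊞_
    ; ε       = neutral
    ; _⁻¹     = inverse
    ; isAbelianGroup = record
      { isGroup = record
        { isMonoid = record
          { isSemigroup = record
            { isMagma = record
              { isEquivalence = record
                { refl  = λ _ → refl
                ; sym   = λ p v → sym (p v)
                ; trans = λ p q v → trans (p v) (q v)
                }
              ; ∙-cong = ⊞-cong
              }
            ; assoc = λ a b c → ⊞-assoc (proj₁ a) (proj₁ b) (proj₁ c)
            }
          ; identity = (λ c v → trans (⊞-comm e (proj₁ c) v) (⊕e (proj₂ c) v)) , λ c → ⊕e (proj₂ c)
          }
        ; inverse = (λ c v → trans (⊞-comm (proj₁ (inverse c)) (proj₁ c) v) (⊞-inverse c v)) , ⊞-inverse
        ; ⁻¹-cong = λ {c} {d} p → ⊞-cancel c (inverse c) (inverse d) λ v →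
            trans (trans (⊞-comm (proj₁ (inverse c)) (proj₁ c) v) (⊞-inverse c v))
              (sym (trans (⊞-cong {a = proj₁ (inverse d)} (λ _ → refl) p v)
                (trans (⊞-comm (proj₁ (inverse d)) (proj₁ d) v) (⊞-inverse d v))))
        }
      ; comm = λ c d → ⊞-comm (proj₁ c) (proj₁ d)
      }
    }

  Δ̃₀ : Ṽ → (Ṽ → ℤ)
  Δ̃₀ v w = + (outdeg (ι v) * δ v w) ℤ.- + wt (ι v) (ι w)

  Δ̃ : (Ṽ → ℤ) → (Ṽ → ℤ)
  Δ̃ = linear Δ̃₀

  ℤṼ/imΔ̃ : AbelianGroup 0ℓ 0ℓ
  ℤṼ/imΔ̃ = coker Δ̃₀

  module Q = AbelianGroup ℤṼ/imΔ̃

  class : Config → Q.Carrier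
  class c v = + c v

  ≗⇒≈ : {x y : Ṽ → ℤ} → x ≗ y → x Q.≈ y
  ≗⇒≈ {x} {y} p = (λ _ → 0ℤ) , λ w → trans (ℤ.i≡j⇒i-j≡0 (p w)) (sym (linear-0 Δ̃₀ w))

  fire-ℤ : ∀ c v w → Unstable c v → + fire c v w ≡ + c w ℤ.- Δ̃₀ v w
  fire-ℤ c v w u = begin
    + fire c v w                        ≡⟨ lem₁ (+ fire c v w) (+ k) ⟩
    (+ (fire c v w + k)) ℤ.- + k        ≡⟨ cong (λ x → + x ℤ.- + k) (fire-eq c v w u) ⟩
    + (c w + wt (ι v) (ι w)) ℤ.- + k    ≡⟨ lem₂ (+ c w) (+ wt (ι v) (ι w)) (+ k) ⟩
    + c w ℤ.- Δ̃₀ v w ∎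
    where
    open ≡-Reasoning
    k = outdeg (ι v) * δ v w
    lem₁ : ∀ f k → f ≡ (f ℤ.+ k) ℤ.- k
    lem₁ = ℤ-Solver.solve-∀
    lem₂ : ∀ c w k → (c ℤ.+ w) ℤ.- k ≡ c ℤ.- (k ℤ.- w)
    lem₂ = ℤ-Solver.solve-∀

  class-↠ : ∀ {c d} → c ↠ d → class c Q.≈ class d
  class-↠ (done p) = ≗⇒≈ λ v → cong +_ (p v)
  class-↠ {c} {d} (step v u p) = Q.trans {class c} {class (fire c v)} {class d} (basis v , eq) (class-↠ p)
    where
    lem : ∀ c d → c ℤ.- (c ℤ.- d) ≡ d
    lem = ℤ-Solver.solve-∀
    eq : ∀ w → + c w ℤ.- + fire c v w ≡ Δ̃ (basis v) w
    eq w = trans (cong (λ x → + c w ℤ.- x) (fire-ℤ c v w u)) (trans (lem (+ c w) (Δ̃₀ v w)) (sym (linear-basis Δ̃₀ v w)))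

  class-⊞ : ∀ c d → class ((c ⊕ d) °) Q.≈ (class c Q.∙ class d)
  class-⊞ c d = Q.sym {class (c ⊕ d)} {class ((c ⊕ d) °)} (class-↠ (↠° (c ⊕ d)))

  class-e : class e Q.≈ Q.ε
  class-e = GroupProperties.identityˡ-unique Q.group (class e) (class e)
    (Q.trans {i = class e Q.∙ class e} {j = class ((e ⊕ e) °)} {k = class e}
      (Q.sym {class ((e ⊕ e) °)} {class e Q.∙ class e} (class-⊞ e e))
      (≗⇒≈ λ v → cong +_ (⊕e (proj₂ neutral) v)))

  total : List Ṽ → ℕ
  total []      = 0
  total (v ∷ L) = outdeg (ι v) + total L

  Δ̃∑ : List Ṽ → (Ṽ → ℤ)
  Δ̃∑ []      w = 0ℤ
  Δ̃∑ (v ∷ L) w = Δ̃₀ v w ℤ.+ Δ̃∑ L w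

  fire-all : ∀ L c → (∀ w → total L ≤ c w) → ∃ λ d → c ↠ d × (∀ w → + d w ≡ + c w ℤ.- Δ̃∑ L w)
  fire-all [] c _ = c , done (λ _ → refl) , λ w → sym (ℤ.+-identityʳ (+ c w))
  fire-all (v ∷ L) c big =
    let d , p , q = fire-all L (fire c v) big′
    in  d , step v u p , λ w → trans (q w)
          (trans (cong (ℤ._- Δ̃∑ L w) (fire-ℤ c v w u)) (lem (+ c w) (Δ̃₀ v w) (Δ̃∑ L w)))
    where
    lem : ∀ c x y → (c ℤ.- x) ℤ.- y ≡ c ℤ.- (x ℤ.+ y)
    lem = ℤ-Solver.solve-∀
    u : Unstable c v
    u = ℕ.≤-trans (ℕ.m≤m+n _ _) (big v)
    δ≤1 : ∀ w → δ v w ≤ 1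
    δ≤1 w with v ≟ w
    ... | yes _ = ℕ.≤-refl
    ... | no _  = z≤n
    big′ : ∀ w → total L ≤ fire c v w
    big′ w = ℕ.+-cancelˡ-≤ (outdeg (ι v)) _ _ (begin
      outdeg (ι v) + total L                 ≤⟨ big w ⟩
      c w                                    ≤⟨ ℕ.m≤m+n _ _ ⟩
      c w + wt (ι v) (ι w)                   ≡⟨ fire-eq c v w u ⟨
      fire c v w + outdeg (ι v) * δ v w      ≤⟨ ℕ.+-monoʳ-≤ (fire c v w) (ℕ.*-monoʳ-≤ (outdeg (ι v)) (δ≤1 w)) ⟩
      fire c v w + outdeg (ι v) * 1          ≡⟨ cong (λ x → fire c v w + x) (ℕ.*-identityʳ (outdeg (ι v))) ⟩
      fire c v w + outdeg (ι v)              ≡⟨ ℕ.+-comm (fire c v w) _ ⟩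
      outdeg (ι v) + fire c v w ∎)
      where open ℕ.≤-Reasoning

  Δ̃∑-replicate : ∀ k v L w → Δ̃∑ (replicate k v ++ L) w ≡ + k ℤ.* Δ̃₀ v w ℤ.+ Δ̃∑ L w
  Δ̃∑-replicate zero v L w = trans (sym (ℤ.+-identityˡ _)) (cong (ℤ._+ Δ̃∑ L w) (sym (ℤ.*-zeroˡ (Δ̃₀ v w))))
  Δ̃∑-replicate (suc k) v L w = trans (cong (λ x → Δ̃₀ v w ℤ.+ x) (Δ̃∑-replicate k v L w))
    (trans (lem (Δ̃₀ v w) (+ k) (Δ̃∑ L w)) (cong (λ x → x ℤ.* Δ̃₀ v w ℤ.+ Δ̃∑ L w) (refl {x = + suc k})))
    where
    lem : ∀ d k x → d ℤ.+ (k ℤ.* d ℤ.+ x) ≡ (+ 1 ℤ.+ k) ℤ.* d ℤ.+ x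
    lem = ℤ-Solver.solve-∀

  split : ∀ {k} (g : Fin k → Ṽ) (z : Fin k → ℤ) → ∃ λ P → ∃ λ N →
          ∀ w → ∑ℤ.sum (λ i → z i ℤ.* Δ̃₀ (g i) w) ≡ Δ̃∑ P w ℤ.- Δ̃∑ N w
  split {zero}  g z = [] , [] , λ _ → refl
  split {suc k} g z with split (g ∘ suc) (z ∘ suc) | z zero
  ... | P , N , p | + j = replicate j (g zero) ++ P , N , λ w →
        trans (cong (λ x → + j ℤ.* Δ̃₀ (g zero) w ℤ.+ x) (p w))
          (trans (lem (+ j ℤ.* Δ̃₀ (g zero) w) (Δ̃∑ P w) (Δ̃∑ N w))
            (cong (ℤ._- Δ̃∑ N w) (sym (Δ̃∑-replicate j (g zero) P w))))
    where
    lem : ∀ x p n → x ℤ.+ (p ℤ.- n) ≡ (x ℤ.+ p) ℤ.- n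
    lem = ℤ-Solver.solve-∀
  ... | P , N , p | -[1+ j ] = P , replicate (suc j) (g zero) ++ N , λ w →
        trans (cong (λ x → -[1+ j ] ℤ.* Δ̃₀ (g zero) w ℤ.+ x) (p w))
          (trans (lem (+ suc j) (Δ̃₀ (g zero) w) (Δ̃∑ P w) (Δ̃∑ N w))
            (cong (ℤ._-_ (Δ̃∑ P w)) (sym (Δ̃∑-replicate (suc j) (g zero) N w))))
    where
    lem : ∀ x d p n → (ℤ.- x) ℤ.* d ℤ.+ (p ℤ.- n) ≡ p ℤ.- (x ℤ.* d ℤ.+ n)
    lem = ℤ-Solver.solve-∀

  class-injective : ∀ {c d} → Recurrent c → Recurrent d → class c Q.≈ class d → c ≗ d
  class-injective {c} {d} c-rec d-rec (z , p) = begin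
    c                   ≈⟨ absorb c-rec ⟨
    (c ⊕ F) °           ≈⟨ °-↠ (proj₁ (proj₂ fire-c)) ⟩
    (proj₁ fire-c) °    ≈⟨ °-cong same ⟩
    (proj₁ fire-d) °    ≈⟨ °-↠ (proj₁ (proj₂ fire-d)) ⟨
    (d ⊕ F) °           ≈⟨ absorb d-rec ⟩
    d ∎
    where
    open ≗-Reasoning
    PN = split (λ v → v) z
    P  = proj₁ PN
    N  = proj₁ (proj₂ PN)
    T  = total P + total N
    F-data = proj₂ (proj₂ neutral) (λ _ → T)
    F : Config
    F = (λ _ → T) ⊕ proj₁ F-data
    absorb : ∀ {c} → Recurrent c → (c ⊕ F) ° ≗ c
    absorb {c} c-rec = begin
      (c ⊕ F) °     ≈⟨ °-⊕ʳ c F ⟨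
      (c ⊕ F °) °   ≈⟨ °-cong (⊕-congˡ c (proj₂ F-data)) ⟩
      (c ⊕ e) °     ≈⟨ ⊕e c-rec ⟩
      c ∎
    T≤ : ∀ c w → T ≤ (c ⊕ F) w
    T≤ c w = ℕ.≤-trans (ℕ.m≤m+n T _) (ℕ.m≤n+m _ (c w))
    fire-c = fire-all P (c ⊕ F) (λ w → ℕ.≤-trans (ℕ.m≤m+n _ _) (T≤ c w))
    fire-d = fire-all N (d ⊕ F) (λ w → ℕ.≤-trans (ℕ.m≤n+m _ _) (T≤ d w))
    lem : ∀ c d F P N → c ℤ.- d ≡ P ℤ.- N → (c ℤ.+ F) ℤ.- P ≡ (d ℤ.+ F) ℤ.- N
    lem c d F P N h = trans (lem₁ c d F P) (trans (cong (λ x → x ℤ.+ (d ℤ.+ F) ℤ.- P) h) (lem₂ d F P N))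
      where
      lem₁ : ∀ c d F P → (c ℤ.+ F) ℤ.- P ≡ (c ℤ.- d) ℤ.+ (d ℤ.+ F) ℤ.- P
      lem₁ = ℤ-Solver.solve-∀
      lem₂ : ∀ d F P N → (P ℤ.- N) ℤ.+ (d ℤ.+ F) ℤ.- P ≡ (d ℤ.+ F) ℤ.- N
      lem₂ = ℤ-Solver.solve-∀
    same : proj₁ fire-c ≗ proj₁ fire-d
    same w = ℤ.+-injective (trans (proj₂ (proj₂ fire-c) w) (trans
      (lem (+ c w) (+ d w) (+ F w) (Δ̃∑ P w) (Δ̃∑ N w) (trans (p w) (proj₂ (proj₂ PN) w)))
      (sym (proj₂ (proj₂ fire-d) w))))

  -- x + a + b is non-negative for a = |x| and (a + b)° = e, so (x + a + b + e)°
  -- is a recurrent representative of x.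
  class-surjective : ∀ x → ∃ λ (c : RecurrentConfig) → class (proj₁ c) Q.≈ x
  class-surjective x = (neutral ⊞′ y) , (begin
    class ((e ⊕ y) °)              ≈⟨ class-⊞ e y ⟩
    class e Q.∙ class y            ≈⟨ Q.∙-cong {class e} {Q.ε} {class y} {x Q.∙ class (a ⊕ b)} class-e (≗⇒≈ y≡) ⟩
    Q.ε Q.∙ (x Q.∙ class (a ⊕ b))  ≈⟨ Q.identityˡ (x Q.∙ class (a ⊕ b)) ⟩
    x Q.∙ class (a ⊕ b)            ≈⟨ Q.∙-cong {x} {x} {class (a ⊕ b)} {Q.ε} (Q.refl {x}) a⊕b≈0 ⟩
    x Q.∙ Q.ε                      ≈⟨ Q.identityʳ x ⟩
    x ∎)
    where
    open SetoidReasoning Q.setoid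
    _⊞′_ : RecurrentConfig → Config → RecurrentConfig
    (c , c-rec) ⊞′ d = (c ⊕ d) ° , recurrent-⊕ c-rec d
    a b y : Config
    a v = ∣ x v ∣
    b-data = proj₂ (proj₂ neutral) a
    b = proj₁ b-data
    y v = ∣ x v ℤ.+ + a v ∣ + b v
    nonneg : ∀ i → + ∣ i ℤ.+ + ∣ i ∣ ∣ ≡ i ℤ.+ + ∣ i ∣
    nonneg (+ i)    = refl
    nonneg -[1+ i ] rewrite ℤ.n⊖n≡0 (suc i) = refl
    y≡ : class y ≗ (x Q.∙ class (a ⊕ b))
    y≡ v = trans (cong (ℤ._+ + b v) (nonneg (x v))) (ℤ.+-assoc (x v) (+ a v) (+ b v))
    a⊕b≈0 : class (a ⊕ b) Q.≈ Q.ε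
    a⊕b≈0 = Q.trans {class (a ⊕ b)} {class e} {Q.ε}
      (class-↠ (↠-respʳ (proj₂ b-data) (↠° (a ⊕ b)))) class-e

  class-isIsomorphism : IsGroupIsomorphism (AbelianGroup.rawGroup 𝒮) Q.rawGroup (class ∘ proj₁)
  class-isIsomorphism = record
    { isGroupMonomorphism = record
      { isGroupHomomorphism = record
        { isMonoidHomomorphism = record
          { isMagmaHomomorphism = record
            { isRelHomomorphism = record { cong = λ p → ≗⇒≈ λ v → cong +_ (p v) }
            ; homo = λ c d → class-⊞ (proj₁ c) (proj₁ d)
            }
          ; ε-homo = class-e
          }
        ; ⁻¹-homo = λ c → GroupProperties.inverseˡ-unique Q.group (class (proj₁ (inverse c))) (class (proj₁ c))
            (begin
              class (proj₁ (inverse c)) Q.∙ class (proj₁ c)     ≈⟨ class-⊞ (proj₁ (inverse c)) (proj₁ c) ⟨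
              class ((proj₁ (inverse c) ⊕ proj₁ c) °)           ≈⟨ ≗⇒≈ (λ v → cong +_ (AbelianGroup.inverseˡ 𝒮 c v)) ⟩
              class e                                           ≈⟨ class-e ⟩
              Q.ε ∎)
        }
      ; injective = λ {c} {d} → class-injective (proj₂ c) (proj₂ d)
      }
    ; surjective = λ x → let c , p = class-surjective x in c , λ {d} q →
        Q.trans {class (proj₁ d)} {class (proj₁ c)} {x} (≗⇒≈ λ v → cong +_ (q v)) p
    }
    where open SetoidReasoning Q.setoid

  -- class-isIsomorphism inverted: r x is the recurrent configuration with class x.
  r : Q.Carrier → RecurrentConfig
  r x = proj₁ (IsGroupIsomorphism.surjective class-isIsomorphism x)

record FiniteGroup (a ℓ : Level) : Set (lsuc (a ⊔ ℓ)) where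
  field
    group       : Group a ℓ
    order       : ℕ
    enumeration : Inverse (Group.setoid group) (setoid (Fin order))

  open Group group public

record Action {a ℓ} (G : FiniteGroup a ℓ) (Γ : SandpileGraph) : Set (a ⊔ ℓ) where
  open FiniteGroup G using (Carrier; _≈_; _∙_) renaming (ε to 1#)
  open SandpileGraph Γ
  infixr 7 _·_
  field
    _·_       : Carrier → V → V
    ·-cong    : ∀ {g h} → g ≈ h → ∀ v → g · v ≡ h · v
    1#-act    : ∀ v → 1# · v ≡ v
    ∙-act     : ∀ g h v → (g ∙ h) · v ≡ g · h · v
    fixes-s   : ∀ g → g · s ≡ s
    preserves : ∀ g v w → E v w → E (g · v) (g · w) × wt (g · v) (g · w) ≡ wt v w

module Symmetrized {a ℓ} (Γ : SandpileGraph) (G : FiniteGroup a ℓ) (A : Action G Γ) where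
  open SandpileGraph Γ public
  open SandpileGroup Γ public
  open Action A public
  module G = FiniteGroup G
  open G using (_⁻¹)

  ⁻¹·· : ∀ g v → g ⁻¹ · g · v ≡ v
  ⁻¹·· g v = trans (sym (∙-act (g ⁻¹) g v)) (trans (·-cong (G.inverseˡ g) v) (1#-act v))

  ·⁻¹· : ∀ g v → g · g ⁻¹ · v ≡ v
  ·⁻¹· g v = trans (sym (∙-act g (g ⁻¹) v)) (trans (·-cong (G.inverseʳ g) v) (1#-act v))

  ·-injective : ∀ g {v w} → g · v ≡ g · w → v ≡ w
  ·-injective g {v} {w} p = trans (sym (⁻¹·· g v)) (trans (cong (g ⁻¹ ·_) p) (⁻¹·· g w))

  s≢g·ι : ∀ g v → s ≢ g · ι v
  s≢g·ι g v p = punchInᵢ≢i s v (·-injective g (trans (sym p) (sym (fixes-s g))))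

  infixr 7 _▷_
  _▷_ : G.Carrier → Ṽ → Ṽ
  g ▷ v = punchOut (s≢g·ι g v)

  ι-▷ : ∀ g v → ι (g ▷ v) ≡ g · ι v
  ι-▷ g v = punchIn-punchOut (s≢g·ι g v)

  ι-injective : ∀ {v w} → ι v ≡ ι w → v ≡ w
  ι-injective = punchIn-injective s _ _

  ▷-1# : ∀ v → G.ε ▷ v ≡ v
  ▷-1# v = ι-injective (trans (ι-▷ G.ε v) (1#-act (ι v)))

  ▷-cong : ∀ {g h} → g G.≈ h → ∀ v → g ▷ v ≡ h ▷ v
  ▷-cong {g} {h} p v = ι-injective (trans (ι-▷ g v) (trans (·-cong p (ι v)) (sym (ι-▷ h v))))

  ▷-∙ : ∀ g h v → (g G.∙ h) ▷ v ≡ g ▷ h ▷ v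
  ▷-∙ g h v = ι-injective (begin
    ι ((g G.∙ h) ▷ v)   ≡⟨ ι-▷ (g G.∙ h) v ⟩
    (g G.∙ h) · ι v     ≡⟨ ∙-act g h (ι v) ⟩
    g · h · ι v         ≡⟨ cong (g ·_) (ι-▷ h v) ⟨
    g · ι (h ▷ v)       ≡⟨ ι-▷ g (h ▷ v) ⟨
    ι (g ▷ h ▷ v) ∎)
    where open ≡-Reasoning

  ⁻¹▷▷ : ∀ g v → g ⁻¹ ▷ g ▷ v ≡ v
  ⁻¹▷▷ g v = trans (sym (▷-∙ (g ⁻¹) g v)) (trans (▷-cong (G.inverseˡ g) v) (▷-1# v))

  ▷⁻¹▷ : ∀ g v → g ▷ g ⁻¹ ▷ v ≡ v
  ▷⁻¹▷ g v = trans (sym (▷-∙ g (g ⁻¹) v)) (trans (▷-cong (G.inverseʳ g) v) (▷-1# v))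

  ▷-permutation : G.Carrier → Permutation′ n
  ▷-permutation g = permutation (g ▷_) (g ⁻¹ ▷_) (▷⁻¹▷ g) (⁻¹▷▷ g)

  wt-invariant : ∀ g v w → wt (g · v) (g · w) ≡ wt v w
  wt-invariant g v w with wt v w in p | wt (g · v) (g · w) in q
  ... | zero  | zero  = refl
  ... | suc k | _     = trans (sym q) (trans (proj₂ (preserves g v w (subst (0 <_) (sym p) (s≤s z≤n)))) p)
  ... | zero  | suc k = trans (sym q) (trans (sym (proj₂ (preserves (g ⁻¹) (g · v) (g · w) (subst (0 <_) (sym q) (s≤s z≤n)))))
                          (trans (cong₂ wt (⁻¹·· g v) (⁻¹·· g w)) p))

  outdeg-invariant : ∀ g v → outdeg (g · v) ≡ outdeg v
  outdeg-invariant g v = trans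
    (∑ℕ.sum-permute (wt (g · v)) (permutation (g ·_) (g ⁻¹ ·_) (·⁻¹· g) (⁻¹·· g)))
    (∑ℕ.sum-cong-≗ (wt-invariant g v))

  wt-▷ : ∀ g v w → wt (ι (g ▷ v)) (ι (g ▷ w)) ≡ wt (ι v) (ι w)
  wt-▷ g v w = trans (cong₂ wt (ι-▷ g v) (ι-▷ g w)) (wt-invariant g (ι v) (ι w))

  outdeg-▷ : ∀ g v → outdeg (ι (g ▷ v)) ≡ outdeg (ι v)
  outdeg-▷ g v = trans (cong outdeg (ι-▷ g v)) (outdeg-invariant g (ι v))

  ▷-injective : ∀ g {v w} → g ▷ v ≡ g ▷ w → v ≡ w
  ▷-injective g {v} {w} p = trans (sym (⁻¹▷▷ g v)) (trans (cong (g ⁻¹ ▷_) p) (⁻¹▷▷ g w))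

  δ-▷ : ∀ g v w → δ (g ▷ v) (g ▷ w) ≡ δ v w
  δ-▷ g v w = cong (λ x → if x then 1 else 0) (does-⇔ (mk⇔ (▷-injective g) (cong (g ▷_))) (g ▷ v ≟ g ▷ w) (v ≟ w))

  -- The linear extension of the action: g sends ∑ c(v) v to ∑ c(v) gv.
  infixr 7 _•_
  _•_ : G.Carrier → Config → Config
  (g • c) w = c (g ⁻¹ ▷ w)

  fire-▷ : ∀ g c v → fire (g • c) (g ▷ v) ≗ (g • fire c v)
  fire-▷ g c v w = cong₂ _+_
    (cong (c (g ⁻¹ ▷ w) ∸_) (cong₂ _*_ (outdeg-▷ g v) (move δ (δ-▷ g v))))
    (move (λ x y → wt (ι x) (ι y)) (wt-▷ g v))
    where
    move : (f : Ṽ → Ṽ → ℕ) → (∀ w → f (g ▷ v) (g ▷ w) ≡ f v w) → f (g ▷ v) w ≡ f v (g ⁻¹ ▷ w)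
    move f p = trans (cong (f (g ▷ v)) (sym (▷⁻¹▷ g w))) (p (g ⁻¹ ▷ w))

  unstable-▷ : ∀ g c v → Unstable c v → Unstable (g • c) (g ▷ v)
  unstable-▷ g c v u = subst₂ _≤_ (sym (outdeg-▷ g v)) (cong c (sym (⁻¹▷▷ g v))) u

  stable-• : ∀ g {c} → Stable c → Stable (g • c)
  stable-• g {c} st v u = st (g ⁻¹ ▷ v) (subst (_≤ c (g ⁻¹ ▷ v)) (sym (outdeg-▷ (g ⁻¹) v)) u)

  ↠-• : ∀ g {c d} → c ↠ d → (g • c) ↠ (g • d)
  ↠-• g (done p) = done λ v → p (g ⁻¹ ▷ v)
  ↠-• g {c} (step v u p) = step (g ▷ v) (unstable-▷ g c v u) (↠-respˡ (sym ∘ fire-▷ g c v) (↠-• g p))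

  °-• : ∀ g c → (g • c) ° ≗ (g • c °)
  °-• g c = °-unique (↠-• g (↠° c)) (stable-• g (°-stable c))

  recurrent-• : ∀ g {c} → Recurrent c → Recurrent (g • c)
  recurrent-• g {c} (st , rec) = stable-• g st , λ a →
    let a′ = λ w → a (g ▷ w)
        b , p = rec a′
    in g • b , λ v → trans (°-cong (λ w → cong (λ x → a x + b (g ⁻¹ ▷ w)) (sym (▷⁻¹▷ g w))) v)
                       (trans (°-• g (a′ ⊕ b) v) (p (g ⁻¹ ▷ v)))

  Invariant : RecurrentConfig → Set a
  Invariant c = ∀ g → (g • proj₁ c) ≗ proj₁ c

  invariant-⊞ : ∀ {c d} → Invariant c → Invariant d → Invariant (c ⊞ d)
  invariant-⊞ {c , _} {d , _} p q g v = trans (sym (°-• g (c ⊕ d) v)) (⊞-cong (p g) (q g) v)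

  invariant-neutral : Invariant neutral
  invariant-neutral g = ⊞-cancel ge ge neutral λ v → trans (idem v)
    (sym (trans (⊞-comm e (g • e) v) (⊕e (proj₂ ge) v)))
    where
    ge : RecurrentConfig
    ge = g • e , recurrent-• g (proj₂ neutral)
    idem : ((g • e) ⊕ (g • e)) ° ≗ (g • e)
    idem v = trans (°-• g (e ⊕ e) v) (⊕e (proj₂ neutral) (g ⁻¹ ▷ v))

  invariant-inverse : ∀ {c} → Invariant c → Invariant (inverse c)
  invariant-inverse {c} p g = ⊞-cancel c (g • c⁻¹ , recurrent-• g (proj₂ (inverse c))) (inverse c) (begin
    ((g • c⁻¹) ⊕ proj₁ c) °         ≈⟨ °-cong (⊕-congˡ (g • c⁻¹) (p g)) ⟨
    ((g • c⁻¹) ⊕ (g • proj₁ c)) °   ≈⟨ °-• g (c⁻¹ ⊕ proj₁ c) ⟩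
    g • ((c⁻¹ ⊕ proj₁ c) °)         ≈⟨ (λ v → AbelianGroup.inverseˡ 𝒮 c (g ⁻¹ ▷ v)) ⟩
    g • e                           ≈⟨ invariant-neutral g ⟩
    e                               ≈⟨ AbelianGroup.inverseˡ 𝒮 c ⟨
    (c⁻¹ ⊕ proj₁ c) ° ∎)
    where
    open ≗-Reasoning
    c⁻¹ = proj₁ (inverse c)

  𝒮ᴳ : AbelianGroup a 0ℓ
  𝒮ᴳ = record
    { Carrier = Σ RecurrentConfig Invariant
    ; _≈_     = λ c d → proj₁ c S.≈ proj₁ d
    ; _∙_     = λ (c , p) (d , q) → c S.∙ d , invariant-⊞ {c} {d} p q
    ; ε       = S.ε , invariant-neutral
    ; _⁻¹     = λ (c , p) → c S.⁻¹ , invariant-inverse {c} p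
    ; isAbelianGroup = record
      { isGroup = record
        { isMonoid = record
          { isSemigroup = record
            { isMagma = record
              { isEquivalence = record
                { refl  = λ {c} → S.refl {proj₁ c}
                ; sym   = λ {c} {d} → S.sym {proj₁ c} {proj₁ d}
                ; trans = λ {c} {d} {f} → S.trans {proj₁ c} {proj₁ d} {proj₁ f}
                }
              ; ∙-cong = λ {c} {d} {f} {h} → S.∙-cong {proj₁ c} {proj₁ d} {proj₁ f} {proj₁ h}
              }
            ; assoc = λ c d f → S.assoc (proj₁ c) (proj₁ d) (proj₁ f)
            }
          ; identity = (λ c → S.identityˡ (proj₁ c)) , (λ c → S.identityʳ (proj₁ c))
          }
        ; inverse = (λ c → S.inverseˡ (proj₁ c)) , (λ c → S.inverseʳ (proj₁ c))
        ; ⁻¹-cong = λ {c} {d} → S.⁻¹-cong {proj₁ c} {proj₁ d}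
        }
      ; comm = λ c d → S.comm (proj₁ c) (proj₁ d)
      }
    }
    where module S = AbelianGroup 𝒮

  InOrbit : Ṽ → Ṽ → Set a
  InOrbit v w = ∃ λ g → g ▷ v ≡ w

  inOrbit? : ∀ v w → Dec (InOrbit v w)
  inOrbit? v w = map′
    (λ (i , p) → from i , p)
    (λ (g , p) → to g , trans (▷-cong (strictlyInverseʳ g) v) p)
    (any? λ i → from i ▷ v ≟ w)
    where open Inverse G.enumeration

  orbit : Ṽ → Subset n
  orbit v = tabulate λ w → does (inOrbit? v w)

  orbits : List (Subset n)
  orbits = deduplicate (≡-dec Bool._≟_) (List.map orbit (allFin n))

  -- orbits lists every orbit exactly once, so its positions serve as the orbits.
  𝒪 : Set
  𝒪 = Fin (List.length orbits)

  members : 𝒪 → Subset n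
  members = List.lookup orbits

  orbit∈orbits : ∀ v → orbit v ∈ orbits
  orbit∈orbits v = ∈-deduplicate⁺ (≡-dec Bool._≟_) (∈-map⁺ orbit (∈-allFin v))

  [_] : Ṽ → 𝒪
  [ v ] = Any.index (orbit∈orbits v)

  members-[] : ∀ v → members [ v ] ≡ orbit v
  members-[] v = sym (Any.lookup-index (orbit∈orbits v))

  representative : ∀ o → ∃ λ v → members o ≡ orbit v
  representative o =
    let v , _ , p = ∈-map⁻ orbit (∈-deduplicate⁻ (≡-dec Bool._≟_) (List.map orbit (allFin n)) (∈-lookup o))
    in v , p

  rep : 𝒪 → Ṽ
  rep o = proj₁ (representative o)

  -- ∑∈ S f is the sum of f(u) over u ∈ S.
  ∑∈ : Subset n → (Ṽ → ℤ) → ℤ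
  ∑∈ S f = ∑ℤ.sum λ u → if lookup S u then f u else 0ℤ

  -- Δ̃ᴳ on basis elements; by Δ̃ᴳ-component below, the choice of rep p ∈ p is immaterial.
  Δ̃ᴳ₀ : 𝒪 → (𝒪 → ℤ)
  Δ̃ᴳ₀ o p = ∑∈ (members o) λ u → Δ̃ (basis u) (rep p)

  Δ̃ᴳ : (𝒪 → ℤ) → (𝒪 → ℤ)
  Δ̃ᴳ = linear Δ̃ᴳ₀

  ℤ𝒪/imΔ̃ᴳ : AbelianGroup 0ℓ 0ℓ
  ℤ𝒪/imΔ̃ᴳ = coker Δ̃ᴳ₀

  -- ∑_{w ∈ Gv} w
  orbitSum : Ṽ → (Ṽ → ℤ)
  orbitSum v x = ∑∈ (orbit v) λ w → basis w x

  inOrbit-∙ : ∀ g {v w} → InOrbit v w → InOrbit v (g ▷ w)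
  inOrbit-∙ g (h , p) = g G.∙ h , trans (▷-∙ g h _) (cong (g ▷_) p)

  lookup-orbit : ∀ v w → lookup (orbit v) w ≡ does (inOrbit? v w)
  lookup-orbit v = lookup∘tabulate (λ w → does (inOrbit? v w))

  orbit-▷ : ∀ g v w → lookup (orbit v) (g ▷ w) ≡ lookup (orbit v) w
  orbit-▷ g v w = trans (lookup-orbit v (g ▷ w)) (trans
    (does-⇔ (mk⇔ (λ p → subst (InOrbit v) (⁻¹▷▷ g w) (inOrbit-∙ (g ⁻¹) p)) (inOrbit-∙ g))
      (inOrbit? v (g ▷ w)) (inOrbit? v w))
    (sym (lookup-orbit v w)))

  orbit-≡ : ∀ {v w} → orbit v ≡ orbit w → InOrbit w v
  orbit-≡ {v} {w} p with inOrbit? w v in q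
  ... | yes r = r
  ... | no _ with trans (sym (dec-true (inOrbit? v v) (G.ε , ▷-1# v)))
                    (trans (sym (lookup-orbit v v)) (trans (cong (λ S → lookup S v) p)
                      (trans (lookup-orbit w v) (cong does q))))
  ...   | ()

  Δ̃-▷ : ∀ g u w → Δ̃ (basis (g ▷ u)) (g ▷ w) ≡ Δ̃ (basis u) w
  Δ̃-▷ g u w = trans (linear-basis Δ̃₀ (g ▷ u) (g ▷ w)) (trans
    (cong₂ (λ x y → + x ℤ.- + y) (cong₂ _*_ (outdeg-▷ g u) (δ-▷ g u w)) (wt-▷ g u w))
    (sym (linear-basis Δ̃₀ u w)))

  Δ̃ᴳ-component : ∀ v w → Δ̃ᴳ (basis [ v ]) [ w ] ≡ ∑∈ (orbit v) λ u → Δ̃ (basis u) w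
  Δ̃ᴳ-component v w =
    let g , p = orbit-≡ {rep [ w ]} {w} (trans (sym (proj₂ (representative [ w ]))) (members-[] w)) in begin
    Δ̃ᴳ (basis [ v ]) [ w ]                            ≡⟨ linear-basis Δ̃ᴳ₀ [ v ] [ w ] ⟩
    Δ̃ᴳ₀ [ v ] [ w ]                                   ≡⟨ cong (λ S → ∑∈ S λ u → Δ̃ (basis u) (rep [ w ])) (members-[] v) ⟩
    ∑∈ (orbit v) (λ u → Δ̃ (basis u) (rep [ w ]))      ≡⟨ cong (λ x → ∑∈ (orbit v) λ u → Δ̃ (basis u) x) p ⟨
    ∑∈ (orbit v) (λ u → Δ̃ (basis u) (g ▷ w))          ≡⟨ ∑ℤ.sum-permute (λ u → if lookup (orbit v) u then Δ̃ (basis u) (g ▷ w) else 0ℤ) (▷-permutation g) ⟩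
    ∑ℤ.sum (λ u → if lookup (orbit v) (g ▷ u) then Δ̃ (basis (g ▷ u)) (g ▷ w) else 0ℤ)
      ≡⟨ ∑ℤ.sum-cong-≗ (λ u → cong₂ (λ x y → if x then y else 0ℤ) (orbit-▷ g v u) (Δ̃-▷ g u w)) ⟩
    ∑∈ (orbit v) (λ u → Δ̃ (basis u) w) ∎
    where open ≡-Reasoning

{-# OPTIONS --safe #-}

-- Identify ℤ𝒪 with the G-invariant elements of ℤṼ through y ↦ (u ↦ y [ u ]), which sends
-- the basis element Gv to ∑_{w ∈ Gv} w and intertwines Δ̃ᴳ with Δ̃.  By equivariance of Δ̃
-- the recurrent representative of an invariant element is invariant.  The one point needing
-- an argument is that Δ̃ z is invariant only for invariant z, and this holds because
-- Δ̃ is injective: the potential h strictly decreases on average along the edges out of a vertex.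
module Submission where

open import Defs
open import Algebra.Bundles using (AbelianGroup)
open import Algebra.Morphism.Structures using (IsGroupHomomorphism; IsGroupIsomorphism)
open import Data.Product.Base using (∃; _×_; proj₁)
open AbelianGroup using (Carrier; rawGroup)

import Data.Bool.Properties as Bool
open import Data.Bool.Base using (true; false; if_then_else_)
open import Data.Fin.Base using (Fin; zero; suc)
open import Data.Fin.Properties using (_≟_; punchInᵢ≢i)
open import Data.Integer.Base as ℤ using (ℤ; +_; -[1+_]; 0ℤ; ∣_∣)
import Data.Integer.Properties as ℤ
import Data.Integer.Tactic.RingSolver as ℤ-Solver
open import Data.List.Base using (List; _∷_; allFin; lookup; map)
open import Data.List.Membership.Propositional.Properties using (∈-lookup)
import Data.List.Relation.Unary.All as All
open import Data.List.Relation.Unary.AllPairs using (_∷_)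
open import Data.List.Relation.Unary.Unique.DecPropositional.Properties using (deduplicate-!)
open import Data.List.Relation.Unary.Unique.Propositional using (Unique)
open import Data.Nat.Base as ℕ using (ℕ; zero; suc)
import Data.Nat.Properties as ℕ
import Data.Nat.Tactic.RingSolver as ℕ-Solver
open import Data.Product.Base using (_,_; proj₂)
import Data.Vec.Base as Vec
open import Data.Vec.Properties using (≡-dec; tabulate-cong)
open import Function.Base using (_∘_)
open import Function.Bundles using (mk⇔)
open import Relation.Binary.PropositionalEquality hiding ([_])
open import Relation.Nullary using (contradiction)
open import Relation.Nullary.Decidable using (does-⇔)

-- Lists without repetition and finite sums of integers.

lookup-injective : ∀ {a} {A : Set a} {xs : List A} → Unique xs →
                   ∀ {i j} → lookup xs i ≡ lookup xs j → i ≡ j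
lookup-injective (_ ∷ _)    {zero}  {zero}  _ = refl
lookup-injective (x∉ ∷ _)   {zero}  {suc j} p = contradiction p (All.lookup x∉ (∈-lookup j))
lookup-injective (x∉ ∷ _)   {suc i} {zero}  p = contradiction (sym p) (All.lookup x∉ (∈-lookup i))
lookup-injective (_ ∷ uniq) {suc i} {suc j} p = cong suc (lookup-injective uniq p)

δ-sym : ∀ {m} (i j : Fin m) → δ i j ≡ δ j i
δ-sym i j = cong (λ b → if b then 1 else 0) (does-⇔ (mk⇔ sym sym) (i ≟ j) (j ≟ i))

∑-basisˡ : ∀ {m} (i : Fin m) (f : Fin m → ℤ) → ∑ℤ.sum (λ j → basis i j ℤ.* f j) ≡ f i
-- The matrix ignores its column index, so the final `i` is only a placeholder.
∑-basisˡ i f = linear-basis (λ j _ → f j) i i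

linear-id : ∀ {m} (x : Fin m → ℤ) → linear basis x ≗ x
linear-id x w = trans
  (∑ℤ.sum-cong-≗ λ v → trans (ℤ.*-comm (x v) (+ δ v w)) (cong (λ k → + k ℤ.* x v) (δ-sym v w)))
  (∑-basisˡ w x)

∣∑∣≤∑∣∣ : ∀ {m} (f : Fin m → ℤ) → ∣ ∑ℤ.sum f ∣ ℕ.≤ ∑ℕ.sum (λ i → ∣ f i ∣)
∣∑∣≤∑∣∣ {zero}  f = ℕ.≤-refl
∣∑∣≤∑∣∣ {suc m} f = ℕ.≤-trans (ℤ.∣i+j∣≤∣i∣+∣j∣ (f zero) _)
  (ℕ.+-monoʳ-≤ ∣ f zero ∣ (∣∑∣≤∑∣∣ (f ∘ suc)))

-- Subgroups of ℤᵐ and homomorphisms out of a cokernel.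

record IsSubgroupOfℤ^ {m p} (P : (Fin m → ℤ) → Set p) : Set p where
  field
    resp-≗ : ∀ {x y} → x ≗ y → P x → P y
    0∈     : P (λ _ → 0ℤ)
    +∈     : ∀ {x y} → P x → P y → P (λ w → x w ℤ.+ y w)
    -∈     : ∀ {x} → P x → P (λ w → ℤ.- x w)

  ℕ*∈ : ∀ k {x} → P x → P (λ w → + k ℤ.* x w)
  ℕ*∈ zero    {x} px = resp-≗ (λ w → sym (ℤ.*-zeroˡ (x w))) 0∈
  ℕ*∈ (suc k) {x} px = resp-≗ (λ w → sym (ℤ.suc-* (+ k) (x w))) (+∈ px (ℕ*∈ k px))

  *∈ : ∀ k {x} → P x → P (λ w → k ℤ.* x w)
  *∈ (+ k)    px     = ℕ*∈ k px
  *∈ -[1+ k ] {x} px = resp-≗ (λ w → ℤ.neg-distribˡ-* (+ suc k) (x w)) (-∈ (ℕ*∈ (suc k) px))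

  linear∈ : ∀ {k} {M : Fin k → Fin m → ℤ} → (∀ i → P (M i)) → ∀ z → P (linear M z)
  linear∈ {zero}  pM z = 0∈
  linear∈ {suc k} pM z = +∈ (*∈ (z zero) (pM zero)) (linear∈ (pM ∘ suc) (z ∘ suc))

  full : (∀ i → P (basis i)) → ∀ x → P x
  full pb x = resp-≗ (linear-id x) (linear∈ pb x)

-- The vectors on which two homomorphisms agree form a subgroup of ℤᵐ. It contains the basis, so it
-- is everything. This gives the uniqueness of the isomorphism.
homomorphism-ext : ∀ {m c ℓ} (M : Fin m → Fin m → ℤ) (H : AbelianGroup c ℓ) {f g} →
  IsGroupHomomorphism (rawGroup (coker M)) (rawGroup H) f →
  IsGroupHomomorphism (rawGroup (coker M)) (rawGroup H) g →
  let open AbelianGroup H in (∀ i → f (basis i) ≈ g (basis i)) → ∀ x → f x ≈ g x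
homomorphism-ext M H {f} {g} f-hom g-hom = IsSubgroupOfℤ^.full {P = λ x → f x H.≈ g x} record
  { resp-≗ = λ p q → H.trans (H.sym (F.⟦⟧-cong (coker-refl p))) (H.trans q (G.⟦⟧-cong (coker-refl p)))
  ; 0∈     = H.trans F.ε-homo (H.sym G.ε-homo)
  ; +∈     = λ {x} {y} p q → H.trans (F.homo x y) (H.trans (H.∙-cong p q) (H.sym (G.homo x y)))
  ; -∈     = λ {x} p → H.trans (F.⁻¹-homo x) (H.trans (H.⁻¹-cong p) (H.sym (G.⁻¹-homo x)))
  }
  where
  module H = AbelianGroup H
  module F = IsGroupHomomorphism f-hom
  module G = IsGroupHomomorphism g-hom
  coker-refl : ∀ {x y} → x ≗ y → AbelianGroup._≈_ (coker M) x y
  coker-refl p = (λ _ → 0ℤ) , λ w → trans (ℤ.i≡j⇒i-j≡0 (p w)) (sym (linear-0 M w))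

-- Injectivity of the reduced Laplacian.

module ReducedLaplacian (Γ : SandpileGraph) where
  open SandpileGraph Γ
  open SandpileGroup Γ

  private
    o : Ṽ → ℕ
    o v = outdeg (ι v)

    wt̃ : Ṽ → Ṽ → ℕ
    wt̃ v w = wt (ι v) (ι w)

    h̃ : Ṽ → ℕ
    h̃ v = h (ι v)

  -- Separating the diagonal from the adjacency part turns `Δ̃ z w ≡ 0ℤ` into a balance equation
  -- between outflow and inflow at `w`.
  Δ̃-split : ∀ z w → Δ̃ z w ≡ z w ℤ.* + o w ℤ.- ∑ℤ.sum (λ v → z v ℤ.* + wt̃ v w)
  Δ̃-split z w = begin
    Δ̃ z w
      ≡⟨ ∑ℤ.sum-cong-≗ (λ v → trans
           (cong (λ x → z v ℤ.* (x ℤ.- + wt̃ v w)) (ℤ.pos-* (o v) (δ v w)))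
           (distrib (z v) (+ o v) (+ δ v w) (+ wt̃ v w))) ⟩
    ∑ℤ.sum (λ v → z v ℤ.* + o v ℤ.* + δ v w ℤ.+ ℤ.- z v ℤ.* + wt̃ v w)
      ≡⟨ ∑ℤ.∑-distrib-+ (λ v → z v ℤ.* + o v ℤ.* + δ v w) (λ v → ℤ.- z v ℤ.* + wt̃ v w) ⟩
    linear basis (λ v → z v ℤ.* + o v) w ℤ.+ linear (λ v w → + wt̃ v w) (λ v → ℤ.- z v) w
      ≡⟨ cong₂ ℤ._+_ (linear-id (λ v → z v ℤ.* + o v) w) (linear-neg (λ v w → + wt̃ v w) z w) ⟩
    z w ℤ.* + o w ℤ.- ∑ℤ.sum (λ v → z v ℤ.* + wt̃ v w) ∎
    where
    open ≡-Reasoning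
    distrib : ∀ z o d t → z ℤ.* (o ℤ.* d ℤ.- t) ≡ z ℤ.* o ℤ.* d ℤ.+ ℤ.- z ℤ.* t
    distrib = ℤ-Solver.solve-∀

  -- The triangle inequality applied to the balance equation of `Δ̃-split`.
  ker-bound : ∀ z → (∀ w → Δ̃ z w ≡ 0ℤ) → ∀ w → ∣ z w ∣ ℕ.* o w ℕ.≤ ∑ℕ.sum (λ v → ∣ z v ∣ ℕ.* wt̃ v w)
  ker-bound z Δz≡0 w = begin
    ∣ z w ∣ ℕ.* o w                            ≡⟨ ℤ.abs-* (z w) (+ o w) ⟨
    ∣ z w ℤ.* + o w ∣                          ≡⟨ cong ∣_∣ (ℤ.i-j≡0⇒i≡j (z w ℤ.* + o w) (∑ℤ.sum (λ v → z v ℤ.* + wt̃ v w)) (trans (sym (Δ̃-split z w)) (Δz≡0 w))) ⟩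
    ∣ ∑ℤ.sum (λ v → z v ℤ.* + wt̃ v w) ∣        ≤⟨ ∣∑∣≤∑∣∣ (λ v → z v ℤ.* + wt̃ v w) ⟩
    ∑ℕ.sum (λ v → ∣ z v ℤ.* + wt̃ v w ∣)        ≡⟨ ∑ℕ.sum-cong-≗ (λ v → ℤ.abs-* (z v) (+ wt̃ v w)) ⟩
    ∑ℕ.sum (λ v → ∣ z v ∣ ℕ.* wt̃ v w) ∎
    where open ℕ.≤-Reasoning

  -- Since `h` vanishes at the sink, leaving the sink out of the sum in `h-shrinks` changes nothing.
  h̃-shrinks : ∀ v → ∑ℕ.sum (λ w → wt̃ v w ℕ.* h̃ w) ℕ.< o v ℕ.* h̃ v
  h̃-shrinks v = subst (ℕ._< o v ℕ.* h̃ v)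
    (∑-drop-s (λ w → wt (ι v) w ℕ.* h w) (trans (cong (wt (ι v) s ℕ.*_) h-s) (ℕ.*-zeroʳ (wt (ι v) s))))
    (h-shrinks (ι v) (punchInᵢ≢i s v))

  -- Pair the bound |z w| outdeg w ≤ ∑ |z v| wt v w with h; as h shrinks strictly, ∑ |z v| ≤ 0.
  Δ̃-injective : ∀ z → (∀ w → Δ̃ z w ≡ 0ℤ) → ∀ v → z v ≡ 0ℤ
  Δ̃-injective z Δz≡0 v = ℤ.∣i∣≡0⇒i≡0 (ℕ.n≤0⇒n≡0 (ℕ.≤-trans (term≤∑ y v) ∑y≤0))
    where
    y S : Ṽ → ℕ
    y v = ∣ z v ∣
    S v = ∑ℕ.sum (λ w → wt̃ v w ℕ.* h̃ w)
    open ℕ.≤-Reasoning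
    move : ∀ y o h → y ℕ.* (o ℕ.* h) ≡ y ℕ.* o ℕ.* h
    move = ℕ-Solver.solve-∀
    exchanged : ∑ℕ.sum (λ w → y w ℕ.* (o w ℕ.* h̃ w)) ℕ.≤ ∑ℕ.sum (λ v → y v ℕ.* S v)
    exchanged = begin
      ∑ℕ.sum (λ w → y w ℕ.* (o w ℕ.* h̃ w))
        ≡⟨ ∑ℕ.sum-cong-≗ (λ w → move (y w) (o w) (h̃ w)) ⟩
      ∑ℕ.sum (λ w → y w ℕ.* o w ℕ.* h̃ w)
        ≤⟨ ∑-mono (λ w → ℕ.*-monoˡ-≤ (h̃ w) (ker-bound z Δz≡0 w)) ⟩
      ∑ℕ.sum (λ w → ∑ℕ.sum (λ v → y v ℕ.* wt̃ v w) ℕ.* h̃ w)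
        ≡⟨ ∑ℕ.sum-cong-≗ (λ w → ∑ℕ.*-distribʳ-sum (h̃ w) (λ v → y v ℕ.* wt̃ v w)) ⟩
      ∑ℕ.sum (λ w → ∑ℕ.sum (λ v → y v ℕ.* wt̃ v w ℕ.* h̃ w))
        ≡⟨ ∑ℕ.∑-comm (λ w v → y v ℕ.* wt̃ v w ℕ.* h̃ w) ⟩
      ∑ℕ.sum (λ v → ∑ℕ.sum (λ w → y v ℕ.* wt̃ v w ℕ.* h̃ w))
        ≡⟨ ∑ℕ.sum-cong-≗ (λ v → ∑ℕ.sum-cong-≗ (λ w → move (y v) (wt̃ v w) (h̃ w))) ⟨
      ∑ℕ.sum (λ v → ∑ℕ.sum (λ w → y v ℕ.* (wt̃ v w ℕ.* h̃ w)))
        ≡⟨ ∑ℕ.sum-cong-≗ (λ v → ∑ℕ.*-distribˡ-sum (y v) (λ w → wt̃ v w ℕ.* h̃ w)) ⟨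
      ∑ℕ.sum (λ v → y v ℕ.* S v) ∎
    ∑y≤0 : ∑ℕ.sum y ℕ.≤ 0
    ∑y≤0 = ℕ.+-cancelʳ-≤ (∑ℕ.sum (λ v → y v ℕ.* S v)) _ _ (begin
      ∑ℕ.sum y ℕ.+ ∑ℕ.sum (λ v → y v ℕ.* S v)   ≡⟨ ∑ℕ.∑-distrib-+ y (λ v → y v ℕ.* S v) ⟨
      ∑ℕ.sum (λ v → y v ℕ.+ y v ℕ.* S v)        ≡⟨ ∑ℕ.sum-cong-≗ (λ v → ℕ.*-suc (y v) (S v)) ⟨
      ∑ℕ.sum (λ v → y v ℕ.* suc (S v))          ≤⟨ ∑-mono (λ v → ℕ.*-monoʳ-≤ (y v) (h̃-shrinks v)) ⟩
      ∑ℕ.sum (λ w → y w ℕ.* (o w ℕ.* h̃ w))      ≤⟨ exchanged ⟩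
      ∑ℕ.sum (λ v → y v ℕ.* S v) ∎)

  -- The inverse isomorphism `r`.

  class-r : ∀ x → class (proj₁ (r x)) Q.≈ x
  class-r x = proj₂ (IsGroupIsomorphism.surjective class-isIsomorphism x) {r x} (λ _ → refl)

  -- A class contains only one recurrent configuration, so `r x` is computed by exhibiting any
  -- recurrent element of the class of `x`. The homomorphism rules for `r` below are instances.
  r-unique : ∀ x (c : RecurrentConfig) → class (proj₁ c) Q.≈ x → proj₁ (r x) ≗ proj₁ c
  r-unique x c p = class-injective (proj₂ (r x)) (proj₂ c)
    (Q.trans {class (proj₁ (r x))} {x} {class (proj₁ c)} (class-r x) (Q.sym {class (proj₁ c)} {x} p))

  r-cong : ∀ x y → x Q.≈ y → proj₁ (r x) ≗ proj₁ (r y)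
  r-cong x y p = r-unique x (r y) (Q.trans {class (proj₁ (r y))} {y} {x} (class-r y) (Q.sym {x} {y} p))

  r-injective : ∀ x y → proj₁ (r x) ≗ proj₁ (r y) → x Q.≈ y
  r-injective x y p = Q.trans {x} {class (proj₁ (r y))} {y}
    (Q.trans {x} {class (proj₁ (r x))} {class (proj₁ (r y))} (Q.sym {class (proj₁ (r x))} {x} (class-r x))
      (≗⇒≈ λ v → cong +_ (p v)))
    (class-r y)

  r-∙ : ∀ x y → proj₁ (r (x Q.∙ y)) ≗ proj₁ (r x ⊞ r y)
  r-∙ x y = r-unique (x Q.∙ y) (r x ⊞ r y)
    (Q.trans {class (proj₁ (r x ⊞ r y))} {class (proj₁ (r x)) Q.∙ class (proj₁ (r y))} {x Q.∙ y}
      (class-⊞ (proj₁ (r x)) (proj₁ (r y)))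
      (Q.∙-cong {class (proj₁ (r x))} {x} {class (proj₁ (r y))} {y} (class-r x) (class-r y)))

  r-⁻¹ : ∀ x → proj₁ (r (x Q.⁻¹)) ≗ proj₁ (inverse (r x))
  r-⁻¹ x = r-unique (x Q.⁻¹) (inverse (r x))
    (Q.trans {class (proj₁ (inverse (r x)))} {class (proj₁ (r x)) Q.⁻¹} {x Q.⁻¹}
      (IsGroupIsomorphism.⁻¹-homo class-isIsomorphism (r x))
      (Q.⁻¹-cong {class (proj₁ (r x))} {x} (class-r x)))

-- Orbits of non-sink vertices.

module _ {a ℓ} (Γ : SandpileGraph) (G : FiniteGroup a ℓ) (A : Action G Γ) where
  open Symmetrized Γ G A
  open ReducedLaplacian Γ
  open G using (_⁻¹)
  private
    module Q𝒪 = AbelianGroup ℤ𝒪/imΔ̃ᴳ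

  -- Deduplication leaves distinct entries, so an orbit determines its position in `orbits`.
  members-injective : ∀ {o p} → members o ≡ members p → o ≡ p
  members-injective = lookup-injective (deduplicate-! (≡-dec Bool._≟_) (map orbit (allFin n)))

  -- With w = gv, an element kv equals (kg⁻¹)w, and kw equals (kg)v.
  orbit-inOrbit : ∀ {v w} → InOrbit v w → orbit v ≡ orbit w
  orbit-inOrbit {v} {w} (g , p) = tabulate-cong λ u → does-⇔
    (mk⇔ (λ (k , q) → k G.∙ g ⁻¹ , trans (▷-∙ k (g ⁻¹) w) (trans (cong (λ x → k ▷ g ⁻¹ ▷ x) (sym p)) (trans (cong (k ▷_) (⁻¹▷▷ g v)) q)))
         (λ (k , q) → k G.∙ g , trans (▷-∙ k g v) (trans (cong (k ▷_) p) q)))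
    (inOrbit? v u) (inOrbit? w u)

  []-cong : ∀ {v w} → InOrbit v w → [ v ] ≡ [ w ]
  []-cong {v} {w} p = members-injective (trans (members-[] v) (trans (orbit-inOrbit p) (sym (members-[] w))))

  []-▷ : ∀ g v → [ g ▷ v ] ≡ [ v ]
  []-▷ g v = sym ([]-cong (g , refl))

  [rep] : ∀ o → [ rep o ] ≡ o
  [rep] o = members-injective (trans (members-[] (rep o)) (sym (proj₂ (representative o))))

  rep-[] : ∀ v → InOrbit (rep [ v ]) v
  rep-[] v = orbit-≡ (trans (sym (members-[] v)) (proj₂ (representative [ v ])))

  -- Membership becomes a Kronecker delta on orbits, so that sums over an orbit can be handled as
  -- linear algebra over the basis of ℤ𝒪.
  inOrbit-δ : ∀ v u → (if Vec.lookup (orbit v) u then 1 else 0) ≡ δ [ u ] [ v ]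
  inOrbit-δ v u = cong (λ b → if b then 1 else 0) (trans (lookup-orbit v u)
    (does-⇔ (mk⇔ (sym ∘ []-cong) (λ p → orbit-≡ (trans (sym (members-[] u)) (trans (cong members p) (members-[] v)))))
      (inOrbit? v u) ([ u ] ≟ [ v ])))

  ∑∈-orbit : ∀ v f → ∑∈ (orbit v) f ≡ ∑ℤ.sum (λ u → basis [ u ] [ v ] ℤ.* f u)
  ∑∈-orbit v f = ∑ℤ.sum-cong-≗ λ u → trans (if-* (Vec.lookup (orbit v) u) (f u)) (cong (λ k → + k ℤ.* f u) (inOrbit-δ v u))
    where
    if-* : ∀ b x → (if b then x else 0ℤ) ≡ + (if b then 1 else 0) ℤ.* x
    if-* true  x = sym (ℤ.*-identityˡ x)
    if-* false x = sym (ℤ.*-zeroˡ x)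

  -- The embedding of ℤ𝒪 into ℤṼ and the two Laplacians.

  lift : (𝒪 → ℤ) → (Ṽ → ℤ)
  lift y u = y [ u ]

  lift-basis : ∀ v → lift (basis [ v ]) ≗ orbitSum v
  lift-basis v x = sym (begin
    orbitSum v x                                          ≡⟨ ∑∈-orbit v (λ w → basis w x) ⟩
    ∑ℤ.sum (λ u → basis [ u ] [ v ] ℤ.* basis u x)        ≡⟨ linear-id (λ u → basis [ u ] [ v ]) x ⟩
    basis [ x ] [ v ]                                     ≡⟨ cong +_ (δ-sym [ x ] [ v ]) ⟩
    basis [ v ] [ x ] ∎)
    where open ≡-Reasoning

  Δ̃ᴳ₀-[] : ∀ o w → Δ̃ᴳ₀ o [ w ] ≡ ∑ℤ.sum (λ u → basis [ u ] o ℤ.* Δ̃₀ u w)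
  -- `Δ̃ᴳ-component` speaks of orbits of the form `[ v ]`; every `o` is one, with `v = rep o`.
  Δ̃ᴳ₀-[] o w = subst (λ o → Δ̃ᴳ₀ o [ w ] ≡ ∑ℤ.sum (λ u → basis [ u ] o ℤ.* Δ̃₀ u w)) ([rep] o) (begin
    Δ̃ᴳ₀ [ v ] [ w ]                                             ≡⟨ linear-basis Δ̃ᴳ₀ [ v ] [ w ] ⟨
    Δ̃ᴳ (basis [ v ]) [ w ]                                      ≡⟨ Δ̃ᴳ-component v w ⟩
    ∑∈ (orbit v) (λ u → Δ̃ (basis u) w)                          ≡⟨ ∑∈-orbit v (λ u → Δ̃ (basis u) w) ⟩
    ∑ℤ.sum (λ u → basis [ u ] [ v ] ℤ.* Δ̃ (basis u) w)          ≡⟨ ∑ℤ.sum-cong-≗ (λ u → cong (basis [ u ] [ v ] ℤ.*_) (linear-basis Δ̃₀ u w)) ⟩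
    ∑ℤ.sum (λ u → basis [ u ] [ v ] ℤ.* Δ̃₀ u w) ∎)
    where
    open ≡-Reasoning
    v = rep o

  -- After exchanging the two sums, the delta in the inner sum over orbits leaves only the term at
  -- `[ u ]`.
  Δ̃-lift : ∀ z w → Δ̃ (lift z) w ≡ lift (Δ̃ᴳ z) w
  Δ̃-lift z w = sym (begin
    ∑ℤ.sum (λ o → z o ℤ.* Δ̃ᴳ₀ o [ w ])
      ≡⟨ ∑ℤ.sum-cong-≗ (λ o → cong (z o ℤ.*_) (Δ̃ᴳ₀-[] o w)) ⟩
    ∑ℤ.sum (λ o → z o ℤ.* ∑ℤ.sum (λ u → basis [ u ] o ℤ.* Δ̃₀ u w))
      ≡⟨ ∑ℤ.sum-cong-≗ (λ o → ∑ℤ.*-distribˡ-sum (z o) (λ u → basis [ u ] o ℤ.* Δ̃₀ u w)) ⟩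
    ∑ℤ.sum (λ o → ∑ℤ.sum (λ u → z o ℤ.* (basis [ u ] o ℤ.* Δ̃₀ u w)))
      ≡⟨ ∑ℤ.∑-comm (λ o u → z o ℤ.* (basis [ u ] o ℤ.* Δ̃₀ u w)) ⟩
    ∑ℤ.sum (λ u → ∑ℤ.sum (λ o → z o ℤ.* (basis [ u ] o ℤ.* Δ̃₀ u w)))
      ≡⟨ ∑ℤ.sum-cong-≗ (λ u → ∑ℤ.sum-cong-≗ (λ o → swap (z o) (basis [ u ] o) (Δ̃₀ u w))) ⟩
    ∑ℤ.sum (λ u → ∑ℤ.sum (λ o → basis [ u ] o ℤ.* (z o ℤ.* Δ̃₀ u w)))
      ≡⟨ ∑ℤ.sum-cong-≗ (λ u → ∑-basisˡ [ u ] (λ o → z o ℤ.* Δ̃₀ u w)) ⟩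
    ∑ℤ.sum (λ u → z [ u ] ℤ.* Δ̃₀ u w) ∎)
    where
    open ≡-Reasoning
    swap : ∀ x y z → x ℤ.* (y ℤ.* z) ≡ y ℤ.* (x ℤ.* z)
    swap = ℤ-Solver.solve-∀

  -- Equivariance and invariant vectors.

  Δ̃-equivariant : ∀ g z w → Δ̃ z (g ▷ w) ≡ Δ̃ (λ v → z (g ▷ v)) w
  Δ̃-equivariant g z w = trans
    (∑ℤ.sum-permute (λ u → z u ℤ.* Δ̃₀ u (g ▷ w)) (▷-permutation g))
    (∑ℤ.sum-cong-≗ λ u → cong (z (g ▷ u) ℤ.*_)
      (trans (sym (linear-basis Δ̃₀ (g ▷ u) (g ▷ w))) (trans (Δ̃-▷ g u w) (linear-basis Δ̃₀ u w))))

  -- The translate of `r x` by `g` is again recurrent and, as `x` is invariant, again has class `x`;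
  -- injectivity of `class` makes it equal to `r x`.
  r-invariant : ∀ x → (∀ g v → x (g ▷ v) ≡ x v) → Invariant (r x)
  r-invariant x x-inv g = class-injective (recurrent-• g (proj₂ (r x))) (proj₂ (r x))
    (Q.trans {class (g • c)} {x} {class c} moved (Q.sym {class c} {x} (class-r x)))
    where
    c = proj₁ (r x)
    z = proj₁ (class-r x)
    moved : class (g • c) Q.≈ x
    -- If c - x is the image of `z`, translating both sides by `g` shows that the translate of c
    -- differs from x by the image of the translated `z`.
    moved = (λ v → z (g ⁻¹ ▷ v)) , λ w → trans
      (cong (λ i → + c (g ⁻¹ ▷ w) ℤ.- i) (sym (x-inv (g ⁻¹) w)))
      (trans (proj₂ (class-r x) (g ⁻¹ ▷ w)) (Δ̃-equivariant (g ⁻¹) z w))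

  -- By equivariance the difference between `z` translated and `z` lies in the kernel of `Δ̃`, which
  -- is zero.
  Δ̃-invariant⁻¹ : ∀ z → (∀ g w → Δ̃ z (g ▷ w) ≡ Δ̃ z w) → ∀ g v → z (g ▷ v) ≡ z v
  Δ̃-invariant⁻¹ z Δz-inv g v = ℤ.i-j≡0⇒i≡j (z (g ▷ v)) (z v)
    (Δ̃-injective (λ v → z (g ▷ v) ℤ.- z v) (λ w → begin
      Δ̃ (λ v → z (g ▷ v) ℤ.- z v) w               ≡⟨ linear-+ Δ̃₀ (λ v → z (g ▷ v)) (λ v → ℤ.- z v) w ⟩
      Δ̃ (λ v → z (g ▷ v)) w ℤ.+ Δ̃ (λ v → ℤ.- z v) w
        ≡⟨ cong₂ ℤ._+_ (trans (sym (Δ̃-equivariant g z w)) (Δz-inv g w)) (linear-neg Δ̃₀ z w) ⟩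
      Δ̃ z w ℤ.- Δ̃ z w                             ≡⟨ ℤ.+-inverseʳ (Δ̃ z w) ⟩
      0ℤ ∎) v)
    where open ≡-Reasoning

  -- An invariant function is constant on orbits, hence is recovered from its values at
  -- representatives.
  invariant-lift : ∀ {b} {B : Set b} (x : Ṽ → B) → (∀ g v → x (g ▷ v) ≡ x v) → ∀ v → x (rep [ v ]) ≡ x v
  invariant-lift x x-inv v = let g , p = rep-[] v in trans (sym (x-inv g (rep [ v ]))) (cong x p)

  lift-cong : ∀ x y → x Q𝒪.≈ y → lift x Q.≈ lift y
  lift-cong x y (z , p) = lift z , λ w → trans (p [ w ]) (sym (Δ̃-lift z w))

  -- The difference of two lifts is invariant, so its preimage `z` under `Δ̃` is invariant too. Thus
  -- `z` is itself a lift, and `Δ̃-lift` carries the relation down to ℤ𝒪.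
  lift-injective : ∀ x y → lift x Q.≈ lift y → x Q𝒪.≈ y
  lift-injective x y (z , p) = z ∘ rep , λ o → begin
    x o ℤ.- y o                           ≡⟨ cong (λ o → x o ℤ.- y o) ([rep] o) ⟨
    lift x (rep o) ℤ.- lift y (rep o)     ≡⟨ p (rep o) ⟩
    Δ̃ z (rep o)                           ≡⟨ ∑ℤ.sum-cong-≗ (λ u → cong (ℤ._* Δ̃₀ u (rep o)) (invariant-lift z z-inv u)) ⟨
    Δ̃ (lift (z ∘ rep)) (rep o)            ≡⟨ Δ̃-lift (z ∘ rep) (rep o) ⟩
    Δ̃ᴳ (z ∘ rep) [ rep o ]                ≡⟨ cong (Δ̃ᴳ (z ∘ rep)) ([rep] o) ⟩
    Δ̃ᴳ (z ∘ rep) o ∎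
    where
    open ≡-Reasoning
    z-inv : ∀ g v → z (g ▷ v) ≡ z v
    z-inv = Δ̃-invariant⁻¹ z λ g w → begin
      Δ̃ z (g ▷ w)                         ≡⟨ p (g ▷ w) ⟨
      lift x (g ▷ w) ℤ.- lift y (g ▷ w)   ≡⟨ cong (λ o → x o ℤ.- y o) ([]-▷ g w) ⟩
      lift x w ℤ.- lift y w               ≡⟨ p w ⟩
      Δ̃ z w ∎

  -- The isomorphism and its surjectivity.

  orbitIso : Carrier ℤ𝒪/imΔ̃ᴳ → Carrier 𝒮ᴳ
  orbitIso y = r (lift y) , r-invariant (lift y) (λ g v → cong y ([]-▷ g v))

  onRep : Carrier 𝒮ᴳ → (𝒪 → ℤ)
  onRep c o = + proj₁ (proj₁ c) (rep o)

  -- For invariant `c` the lift of `onRep c` is the class of `c`, and `c` is already recurrent.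
  orbitIso-onRep : ∀ (c : Carrier 𝒮ᴳ) → proj₁ (proj₁ (orbitIso (onRep c))) ≗ proj₁ (proj₁ c)
  orbitIso-onRep (c , c-inv) = r-unique (λ v → + proj₁ c (rep [ v ])) c
    -- `Invariant` is phrased with the inverse of `g` inside `c`; evaluating it at `g ▷ w` removes
    -- that inverse.
    (≗⇒≈ λ v → cong +_ (sym (invariant-lift (proj₁ c) (λ g w → trans (sym (c-inv g (g ▷ w))) (cong (proj₁ c) (⁻¹▷▷ g w))) v)))

  orbitIso-isIsomorphism : IsGroupIsomorphism (rawGroup ℤ𝒪/imΔ̃ᴳ) (rawGroup 𝒮ᴳ) orbitIso
  orbitIso-isIsomorphism = record
    { isGroupMonomorphism = record
      { isGroupHomomorphism = record
        { isMonoidHomomorphism = record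
          { isMagmaHomomorphism = record
            { isRelHomomorphism = record { cong = λ {x} {y} p → r-cong (lift x) (lift y) (lift-cong x y p) }
            -- `lift` commutes with sums, zero and negatives definitionally, so only the rules for
            -- `r` are needed.
            ; homo = λ x y → r-∙ (lift x) (lift y)
            }
          ; ε-homo = r-unique Q.ε neutral class-e
          }
        ; ⁻¹-homo = λ x → r-⁻¹ (lift x)
        }
      ; injective = λ {x} {y} p → lift-injective x y (r-injective (lift x) (lift y) p)
      }
    ; surjective = λ c → onRep c , λ {y} p v →
        trans (r-cong (lift y) (lift (onRep c)) (lift-cong y (onRep c) p) v) (orbitIso-onRep c v)
    }

proposition2p10 : ∀ {a ℓ} (Γ : SandpileGraph) (G : FiniteGroup a ℓ) (A : Action G Γ) →
    let open Symmetrized Γ G A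
        module 𝒮 = AbelianGroup 𝒮
        module 𝒮ᴳ = AbelianGroup 𝒮ᴳ
    in ∃ λ (φ : Carrier ℤ𝒪/imΔ̃ᴳ → Carrier 𝒮ᴳ) →
         IsGroupIsomorphism (rawGroup ℤ𝒪/imΔ̃ᴳ) (rawGroup 𝒮ᴳ) φ
         × (∀ (v : Ṽ) → proj₁ (φ (basis [ v ])) 𝒮.≈ r (orbitSum v))
         × (∀ (ψ : Carrier ℤ𝒪/imΔ̃ᴳ → Carrier 𝒮ᴳ) →
              IsGroupHomomorphism (rawGroup ℤ𝒪/imΔ̃ᴳ) (rawGroup 𝒮ᴳ) ψ →
              (∀ (v : Ṽ) → proj₁ (ψ (basis [ v ])) 𝒮.≈ r (orbitSum v)) →
              ∀ x → ψ x 𝒮ᴳ.≈ φ x)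
proposition2p10 Γ G A = orbitIso Γ G A , orbitIso-isIsomorphism Γ G A , on-orbits , unique
  where
  open Symmetrized Γ G A
  open ReducedLaplacian Γ
  on-orbits : ∀ v → proj₁ (r (lift Γ G A (basis [ v ]))) ≗ proj₁ (r (orbitSum v))
  on-orbits v = r-cong (lift Γ G A (basis [ v ])) (orbitSum v) (≗⇒≈ (lift-basis Γ G A v))
  unique : ∀ ψ → IsGroupHomomorphism (rawGroup ℤ𝒪/imΔ̃ᴳ) (rawGroup 𝒮ᴳ) ψ →
           (∀ v → proj₁ (proj₁ (ψ (basis [ v ]))) ≗ proj₁ (r (orbitSum v))) →
           ∀ x → proj₁ (proj₁ (ψ x)) ≗ proj₁ (proj₁ (orbitIso Γ G A x))
  unique ψ ψ-hom ψ-orbits = homomorphism-ext Δ̃ᴳ₀ 𝒮ᴳ {ψ} {orbitIso Γ G A} ψ-hom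
    (IsGroupIsomorphism.isGroupHomomorphism (orbitIso-isIsomorphism Γ G A))
    -- The hypothesis on `ψ` concerns basis elements at `[ v ]`; `[rep]` transfers it to an
    -- arbitrary orbit `o`.
    λ o → subst (λ o → proj₁ (proj₁ (ψ (basis o))) ≗ proj₁ (r (lift Γ G A (basis o)))) ([rep] Γ G A o)
      λ v → trans (ψ-orbits (rep o) v) (sym (on-orbits (rep o) v))
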